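{- Let $G$ be a minimal weighted graph, and let $\{G_1,\dots,G_p\}$ and $\{H_1,\dots,H_r\}$ be two pseudofactorizations of $G$ into irreducible weighted graphs. Then the two pseudofactorizations are equivalent in the following sense: there is a bijection between the two families of pseudofactors such that corresponding pseudofactors are isomorphic (i.e. $p=r$, and after reordering $G_i$ is isomorphic to $H_i$ for all $1\le i\le p$).
   Context: Graphs are finite, connected, undirected weighted graphs $G=(V,E,w)$ with $w:E\to\mathbb{R}_{>0}$; $d_G$ denotes the shortest-path metric (minimum total edge weight of a path). $G$ is minimal if $w(uv)=d_G(u,v)$ for every edge $uv\in E$. An isomorphism of weighted graphs is a bijection of vertices preserving adjacency, non-adjacency and edge weights. Cartesian product: for $G_i=(V_i,E_i,w_i)$, $1\le i\le m$, the graph $\prod_{i=1}^m G_i$ has vertex set $V_1\times\cdots\times V_m$; $(u_1,\dots,u_m)(v_1,\dots,v_m)$ is an edge iff there is exactly one index $\ell$ with $u_\ell v_\ell\in E_\ell$ and $u_i=v_i$ for all $i\ne\ell$, and its weight is then $w_\ell(u_\ell v_\ell)$. Pseudofactorization: a finite family $\{G_1^*,\dots,G_m^*\}$ (repetitions allowed) is a pseudofactorization of $G$, and its members are pseudofactors, if with $G^*=\prod_{i=1}^m G_i^*$ there is a map $\pi=(\pi_1,\dots,\pi_m):V(G)\to V(G^*)$ such that: (1) $d_G(u,u')=d_{G^*}(\pi(u),\pi(u'))$ for all $u,u'\in V(G)$; (2) $uv\in E(G)$ implies $\pi(u)\pi(v)\in E(G^*)$ and $w_G(uv)=w_{G^*}(\pi(u)\pi(v))$;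 (3) every vertex of $G_i^*$ is in the image of $\pi_i$, for each $i$; (4) every edge of every $G_i^*$ is the parent of some edge of $G$, where the parent edge of $uv\in E(G)$ under $\pi$ is the edge $\pi_\ell(u)\pi_\ell(v)\in E(G_\ell^*)$ for the unique $\ell$ with $\pi_\ell(u)\neq\pi_\ell(v)$. By convention a pseudofactorization does not include the one-vertex graph $K_1$ unless $G=K_1$. $G$ is irreducible if every pseudofactorization of $G$ includes (a graph isomorphic to) $G$ as a pseudofactor.
   Formalization: Families are nonempty, and K₁ may occur in a pseudofactorization only if G = K₁ and then only as the sole factor; without this, {K₁} and {K₁, K₁} would be two inequivalent irreducible pseudofactorizations of K₁. Nothing changes for G other than K₁. -}

module Defs where

open import Data.Empty using (⊥-elim)
open import Data.Fin using (Fin; zero; suc)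
import Data.Fin.Properties as Fin
open import Data.Nat as ℕ using (ℕ; zero; suc)
import Data.Nat.Properties as ℕ
open import Data.Product using (Σ-syntax; ∃-syntax; ∃₂; _×_; _,_; proj₁; proj₂)
open import Data.Rational as ℚ using (ℚ; 0ℚ; ½; ∣_∣)
import Data.Rational.Properties as ℚ
open import Data.Rational.Solver using (module +-*-Solver)
open import Data.Unit using (⊤)
open import Function using (_∘_)
open import Function.Bundles using (_↔_; _⇔_; Inverse)
open import Relation.Binary.Construct.Closure.ReflexiveTransitive using (Star; ε; _◅_)
open import Relation.Binary.PropositionalEquality using (_≡_; _≢_; refl; sym; cong; subst)
open import Relation.Nullary using (¬_; yes; no)

------------------------------------------------------------------------
-- Real numbers: Cauchy sequences of rationals, with equality _≃_.

record ℝ : Set where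
  constructor mkℝ
  field
    seq    : ℕ → ℚ
    cauchy : ∀ δ → 0ℚ ℚ.< δ →
             ∃[ N ] (∀ m n → N ℕ.≤ m → N ℕ.≤ n → ∣ seq m ℚ.- seq n ∣ ℚ.< δ)

open ℝ public

infix 4 _≃_ _<_ _≤_
infixl 6 _+_

_≃_ : ℝ → ℝ → Set
x ≃ y = ∀ δ → 0ℚ ℚ.< δ →
        ∃[ N ] (∀ n → N ℕ.≤ n → ∣ seq x n ℚ.- seq y n ∣ ℚ.< δ)

-- The sequences must eventually be separated by a fixed positive gap; mere
-- termwise strict inequality would not respect _≃_.
_<_ : ℝ → ℝ → Set
x < y = ∃[ δ ] (0ℚ ℚ.< δ × ∃[ N ] (∀ n → N ℕ.≤ n → seq x n ℚ.+ δ ℚ.≤ seq y n))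

_≤_ : ℝ → ℝ → Set
x ≤ y = ¬ (y < x)

private
  0<½δ : ∀ δ → 0ℚ ℚ.< δ → 0ℚ ℚ.< ½ ℚ.* δ
  0<½δ δ 0<δ = subst (ℚ._< ½ ℚ.* δ) (ℚ.*-zeroʳ ½) (ℚ.*-monoʳ-<-pos ½ 0<δ)

  halves : ∀ δ → ½ ℚ.* δ ℚ.+ ½ ℚ.* δ ≡ δ
  halves = solve 1 (λ d → con ½ :* d :+ con ½ :* d := d) refl
    where open +-*-Solver

  interchange : ∀ a b c d →
    (a ℚ.+ b) ℚ.- (c ℚ.+ d) ≡ (a ℚ.- c) ℚ.+ (b ℚ.- d)
  interchange = solve 4 (λ a b c d →
    (a :+ b) :- (c :+ d) := (a :- c) :+ (b :- d)) refl
    where open +-*-Solver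

0ℝ : ℝ
0ℝ = mkℝ (λ _ → 0ℚ) (λ δ 0<δ → 0 , λ _ _ _ _ → 0<δ)

_+_ : ℝ → ℝ → ℝ
x + y = mkℝ (λ n → seq x n ℚ.+ seq y n) λ δ 0<δ →
  let Nx , px = cauchy x (½ ℚ.* δ) (0<½δ δ 0<δ)
      Ny , py = cauchy y (½ ℚ.* δ) (0<½δ δ 0<δ)
  in Nx ℕ.⊔ Ny , λ m n N≤m N≤n →
     let open ℚ.≤-Reasoning in begin-strict
       ∣ (seq x m ℚ.+ seq y m) ℚ.- (seq x n ℚ.+ seq y n) ∣
         ≡⟨ cong ∣_∣
              (interchange (seq x m) (seq y m) (seq x n) (seq y n)) ⟩
       ∣ (seq x m ℚ.- seq x n) ℚ.+ (seq y m ℚ.- seq y n) ∣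
         ≤⟨ ℚ.∣p+q∣≤∣p∣+∣q∣ (seq x m ℚ.- seq x n) (seq y m ℚ.- seq y n) ⟩
       ∣ seq x m ℚ.- seq x n ∣ ℚ.+ ∣ seq y m ℚ.- seq y n ∣
         <⟨ ℚ.+-mono-<
              (px m n (ℕ.m⊔n≤o⇒m≤o Nx Ny N≤m) (ℕ.m⊔n≤o⇒m≤o Nx Ny N≤n))
              (py m n (ℕ.m⊔n≤o⇒n≤o Nx Ny N≤m) (ℕ.m⊔n≤o⇒n≤o Nx Ny N≤n)) ⟩
       ½ ℚ.* δ ℚ.+ ½ ℚ.* δ
         ≡⟨ halves δ ⟩
       δ ∎

------------------------------------------------------------------------
-- Weighted graphs

-- Weights live on edges only.  `w-sym` identifies the weights of uv and vu; it
-- also makes w independent of the chosen proof of adjacency.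
record WeightedGraph : Set₁ where
  field
    V          : Set
    Adj        : V → V → Set
    w          : ∀ {u v} → Adj u v → ℝ
    adj-sym    : ∀ {u v} → Adj u v → Adj v u
    adj-irrefl : ∀ {u} → ¬ Adj u u
    w-sym      : ∀ {u v} (e : Adj u v) (e′ : Adj v u) → w e ≃ w e′
    w-pos      : ∀ {u v} (e : Adj u v) → 0ℝ < w e

  -- Walks rather than vertex-simple paths: weights being positive, both have
  -- the same minimum total weight.
  Walk : V → V → Set
  Walk = Star Adj

  totalWeight : ∀ {u v} → Walk u v → ℝ
  totalWeight ε       = 0ℝ
  totalWeight (e ◅ p) = w e + totalWeight p

  -- d(u,v) = x
  IsDistance : V → V → ℝ → Set
  IsDistance u v x =
    (Σ[ p ∈ Walk u v ] totalWeight p ≃ x) × (∀ (p : Walk u v) → x ≤ totalWeight p)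

-- Connected graphs are taken to be nonempty, whence Fin (suc n).
record Graph : Set₁ where
  field
    weighted  : WeightedGraph
  open WeightedGraph weighted public
  field
    finite    : ∃[ n ] (V ↔ Fin (suc n))
    connected : ∀ u v → Walk u v

open Graph public using (weighted)

Minimal : Graph → Set
Minimal G = ∀ {u v} (e : Adj u v) → IsDistance u v (w e)
  where open Graph G

infix 4 _≅_

record _≅_ (G H : Graph) : Set where
  private
    module G = Graph G
    module H = Graph H
  field
    bijection : G.V ↔ H.V
  open Inverse bijection using (to)
  field
    adjacency : ∀ {u v} → G.Adj u v ⇔ H.Adj (to u) (to v)
    weight    : ∀ {u v} (e : G.Adj u v) (e′ : H.Adj (to u) (to v)) → G.w e ≃ H.w e′

-- A graph on one vertex has no edges, since loops are excluded.
IsK₁ : Graph → Set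
IsK₁ G = Graph.V G ↔ ⊤

------------------------------------------------------------------------
-- Cartesian products

-- Nested pairs are used instead of dependent functions (i : Fin m) → A i so
-- that propositional equality of tuples is componentwise equality.
Tuple : ∀ {m} → (Fin m → Set) → Set
Tuple {zero}  A = ⊤
Tuple {suc m} A = A zero × Tuple (A ∘ suc)

infixl 9 _!_

_!_ : ∀ {m} {A : Fin m → Set} → Tuple A → ∀ i → A i
(x , xs) ! zero  = x
(x , xs) ! suc i = xs ! i

-- The index ℓ of an edge is automatically unique, because the factors are
-- loopless.
∏ : ∀ {m} → (Fin m → Graph) → WeightedGraph
∏ {m} F = record
  { V          = Tuple (λ i → V (F i))
  ; Adj        = AdjP
  ; w          = λ (ℓ , e , _) → w (F ℓ) e
  ; adj-sym    = λ (ℓ , e , eq) → ℓ , adj-sym (F ℓ) e , λ i i≢ℓ → sym (eq i i≢ℓ)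
  ; adj-irrefl = λ (ℓ , e , _) → adj-irrefl (F ℓ) e
  ; w-sym      = wP-sym
  ; w-pos      = λ (ℓ , e , _) → w-pos (F ℓ) e
  }
  where
  open Graph

  AdjP : Tuple (λ i → V (F i)) → Tuple (λ i → V (F i)) → Set
  AdjP u v = Σ[ ℓ ∈ Fin m ] (Adj (F ℓ) (u ! ℓ) (v ! ℓ) × (∀ i → i ≢ ℓ → u ! i ≡ v ! i))

  wP-sym : ∀ {u v} (e : AdjP u v) (e′ : AdjP v u) →
           w (F (proj₁ e)) (proj₁ (proj₂ e)) ≃ w (F (proj₁ e′)) (proj₁ (proj₂ e′))
  wP-sym {u} {v} (ℓ , e , _) (ℓ′ , e′ , eq′) with ℓ Fin.≟ ℓ′
  ... | yes refl = w-sym (F ℓ) e e′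
  ... | no ℓ≢ℓ′  =
    ⊥-elim (adj-irrefl (F ℓ) (subst (Adj (F ℓ) (u ! ℓ)) (eq′ ℓ ℓ≢ℓ′) e))

------------------------------------------------------------------------
-- Pseudofactorizations

record Pseudofactorization (G : Graph) {m : ℕ} (F : Fin m → Graph) : Set where
  private
    module G  = Graph G
    module G* = WeightedGraph (∏ F)
    module F i = Graph (F i)
  field
    m≥1       : 1 ℕ.≤ m
    π         : G.V → G*.V
    isometric : ∀ u u′ → ∃[ x ] (G.IsDistance u u′ x × G*.IsDistance (π u) (π u′) x)
    edges     : ∀ {u v} (e : G.Adj u v) → Σ[ e* ∈ G*.Adj (π u) (π v) ] G.w e ≃ G*.w e*
    vertices-covered : ∀ i (x : F.V i) → ∃[ u ] π u ! i ≡ x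

  -- The edge xy of F ℓ is the parent of the edge uv of G, with u over x and v
  -- over y; adj-sym makes the choice of orientation immaterial.
  Parent : ∀ ℓ (x y : F.V ℓ) (u v : G.V) → Set
  Parent ℓ x y u v = π u ! ℓ ≢ π v ! ℓ × π u ! ℓ ≡ x × π v ! ℓ ≡ y

  field
    edges-covered : ∀ ℓ {x y} → F.Adj ℓ x y → ∃₂ λ u v → G.Adj u v × Parent ℓ x y u v
    -- K₁ may be used only to factor K₁, and then only as the sole factor:
    -- allowing K₁ = K₁ × K₁ would destroy uniqueness.
    no-K₁         : ∀ i → IsK₁ (F i) → IsK₁ G × m ≡ 1

Irreducible : Graph → Set₁
Irreducible G = ∀ {m} (F : Fin m → Graph) → Pseudofactorization G F → ∃[ i ] F i ≅ G

module Submission where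

-- Call edges ab and xy orthogonal if d(a,x) + d(b,y) = d(a,y) + d(b,x).
--
-- (1) In a pseudofactorization, edges with different indices are orthogonal, and
-- orthogonality of two edges with the same index can be tested in the factor: d is
-- the sum of the distance in the i-th coordinate and a function of the others.
--
-- (2) If every edge in a class S is orthogonal to every edge outside S, then a
-- geodesic has the least total weight of S-edges among all walks with the same ends
-- (Graham and Winkler).  Hence contracting the edges outside S, respectively those
-- in S, gives a two-term pseudofactorization.  When S and its complement are
-- nonempty, both terms have fewer vertices than the graph, so it is not irreducible.
--
-- (3) Let G_i be an irreducible factor of G.  The edges of G_i that come from edges
-- with index j in the other pseudofactorization form a class as in (2), so all edges
-- with index i share an index j there.  By symmetry this is a bijection of indices,
-- and corresponding factors are isomorphic because vertices of G have the same i-th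
-- coordinate iff some geodesic between them has no edge with index i.

open import Defs
open import Algebra.Bundles using (CommutativeMonoid)
import Algebra.Solver.CommutativeMonoid as CMSolver
open import Axiom.ExcludedMiddle using (ExcludedMiddle)
open import Data.Bool using (Bool; true; false; not; if_then_else_)
open import Data.Empty using (⊥; ⊥-elim)
open import Data.Fin using (Fin; zero; suc)
import Data.Fin as Fin
import Data.Fin.Properties as Fin
import Data.Integer as ℤ
open import Data.Nat as ℕ using (ℕ; zero; suc; s≤s; z≤n)
import Data.Nat.Properties as ℕ
open import Data.Product using (Σ-syntax; ∃-syntax; ∃₂; _×_; _,_; proj₁; proj₂)
open import Data.Rational as ℚ using (ℚ; 0ℚ; ½; ∣_∣)
import Data.Rational.Properties as ℚ
open import Data.Rational.Solver using (module +-*-Solver)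
open import Data.Sum using (inj₁; inj₂)
open import Data.Unit using (tt)
open import Function using (_∘_)
open import Function.Bundles using (_↔_; Inverse; mk⇔; mk↔ₛ′)
open import Function.Construct.Identity using (↔-id)
open import Function.Construct.Symmetry using (↔-sym)
open import Function.Definitions using (Injective)
open import Level using (0ℓ)
open import Relation.Binary using (IsEquivalence; Poset)
open import Relation.Binary.Construct.Closure.ReflexiveTransitive using (Star; ε; _◅_; _◅◅_)
import Relation.Binary.Construct.Closure.ReflexiveTransitive as Star
open import Relation.Binary.PropositionalEquality using (_≡_; _≢_; refl; sym; trans; cong; cong₂; subst; subst₂)
import Relation.Binary.Reasoning.PartialOrder as PosetReasoning
open import Relation.Nullary using (¬_; Dec; yes; no; does; ¬?)
open import Relation.Nullary.Decidable using (decidable-stable)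

-- Real numbers

module ℚLemmas where
  open +-*-Solver

  halve-pos : ∀ δ → 0ℚ ℚ.< δ → 0ℚ ℚ.< ½ ℚ.* δ
  halve-pos δ 0<δ = subst (ℚ._< ½ ℚ.* δ) (ℚ.*-zeroʳ ½) (ℚ.*-monoʳ-<-pos ½ 0<δ)

  halve-lt : ∀ δ → 0ℚ ℚ.< δ → ½ ℚ.* δ ℚ.< δ
  halve-lt δ 0<δ = subst₂ ℚ._<_ (ℚ.+-identityʳ _)
    (solve 1 (λ d → con ½ :* d :+ con ½ :* d := d) refl δ)
    (ℚ.+-monoʳ-< (½ ℚ.* δ) (halve-pos δ 0<δ))

  +-cancelʳ-≤ : ∀ r {p q} → p ℚ.+ r ℚ.≤ q ℚ.+ r → p ℚ.≤ q
  +-cancelʳ-≤ r {p} {q} h = subst₂ ℚ._≤_ (eq p) (eq q) (ℚ.+-monoˡ-≤ (ℚ.- r) h)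
    where
    eq : ∀ p → (p ℚ.+ r) ℚ.- r ≡ p
    eq p = solve 2 (λ p r → (p :+ r) :- r := p) refl p r

  p≤∣p∣ : ∀ p → p ℚ.≤ ∣ p ∣
  p≤∣p∣ p with ℚ.≤-total 0ℚ p
  ... | inj₁ 0≤p = ℚ.≤-reflexive (sym (ℚ.0≤p⇒∣p∣≡p 0≤p))
  ... | inj₂ p≤0 = ℚ.≤-trans p≤0 (ℚ.0≤∣p∣ p)

  ∣p-q∣<δ⇒p≤q+δ : ∀ p q {δ} → ∣ p ℚ.- q ∣ ℚ.< δ → p ℚ.≤ q ℚ.+ δ
  ∣p-q∣<δ⇒p≤q+δ p q h = subst (ℚ._≤ _)
    (solve 2 (λ p q → q :+ (p :- q) := p) refl p q)
    (ℚ.+-monoʳ-≤ q (ℚ.≤-trans (p≤∣p∣ (p ℚ.- q)) (ℚ.<⇒≤ h)))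

  p≤q+δ⇒∣p-q∣≤δ : ∀ p q {δ} → p ℚ.≤ q ℚ.+ δ → q ℚ.≤ p ℚ.+ δ → ∣ p ℚ.- q ∣ ℚ.≤ δ
  p≤q+δ⇒∣p-q∣≤δ p q {δ} p≤ q≤ with ℚ.∣p∣≡p∨∣p∣≡-p (p ℚ.- q)
  ... | inj₁ eq = subst (ℚ._≤ δ) (sym eq) (subst (p ℚ.- q ℚ.≤_)
    (solve 2 (λ q d → (q :+ d) :- q := d) refl q δ) (ℚ.+-monoˡ-≤ (ℚ.- q) p≤))
  ... | inj₂ eq = subst₂ ℚ._≤_
    (trans (solve 2 (λ p q → q :- p := :- (p :- q)) refl p q) (sym eq))
    (solve 2 (λ p d → (p :+ d) :- p := d) refl p δ) (ℚ.+-monoˡ-≤ (ℚ.- p) q≤)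

  ∣p-q∣≡∣q-p∣ : ∀ p q → ∣ p ℚ.- q ∣ ≡ ∣ q ℚ.- p ∣
  ∣p-q∣≡∣q-p∣ p q = trans (cong ∣_∣ (solve 2 (λ p q → p :- q := :- (q :- p)) refl p q))
    (ℚ.∣-p∣≡∣p∣ (q ℚ.- p))

  ⅕ : ℚ
  ⅕ = ℤ.+ 1 ℚ./ 5

  fifth-pos : ∀ δ → 0ℚ ℚ.< δ → 0ℚ ℚ.< ⅕ ℚ.* δ
  fifth-pos δ 0<δ = subst (ℚ._< ⅕ ℚ.* δ) (ℚ.*-zeroʳ ⅕) (ℚ.*-monoʳ-<-pos ⅕ 0<δ)

open ℚLemmas

-- Records rather than synonyms for _≃_ and _≤_, so that the two sides can be
-- inferred by unification.
infix 4 _≈_ _≲_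

record _≈_ (x y : ℝ) : Set where
  constructor mk≈
  field
    un≈ : x ≃ y

open _≈_ using (un≈)

record _≲_ (x y : ℝ) : Set where
  constructor mk≲
  field
    un≲ : ∀ δ → 0ℚ ℚ.< δ → ∃[ N ] (∀ n → N ℕ.≤ n → seq x n ℚ.≤ seq y n ℚ.+ δ)

≈⇒≲ : ∀ {x y} → x ≈ y → x ≲ y
≈⇒≲ {x} {y} (mk≈ h) = mk≲ λ δ 0<δ → let N , p = h δ 0<δ in
  N , λ n N≤n → ∣p-q∣<δ⇒p≤q+δ (seq x n) (seq y n) (p n N≤n)

≲-antisym : ∀ {x y} → x ≲ y → y ≲ x → x ≈ y
≲-antisym {x} {y} (mk≲ h) (mk≲ k) = mk≈ λ δ 0<δ →
  let N , p = h (½ ℚ.* δ) (halve-pos δ 0<δ)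
      M , q = k (½ ℚ.* δ) (halve-pos δ 0<δ)
  in N ℕ.⊔ M , λ n N⊔M≤n → ℚ.≤-<-trans
       (p≤q+δ⇒∣p-q∣≤δ (seq x n) (seq y n) (p n (ℕ.m⊔n≤o⇒m≤o N M N⊔M≤n)) (q n (ℕ.m⊔n≤o⇒n≤o N M N⊔M≤n)))
       (halve-lt δ 0<δ)

pointwise-≤ : ∀ {x y} → (∀ n → seq x n ℚ.≤ seq y n) → x ≲ y
pointwise-≤ {x} {y} h = mk≲ λ δ 0<δ → 0 , λ n _ →
  ℚ.≤-trans (h n) (subst (ℚ._≤ seq y n ℚ.+ δ) (ℚ.+-identityʳ (seq y n))
    (ℚ.+-monoʳ-≤ (seq y n) (ℚ.<⇒≤ 0<δ)))

pointwise-≡ : ∀ {x y} → (∀ n → seq x n ≡ seq y n) → x ≈ y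
pointwise-≡ h = ≲-antisym (pointwise-≤ λ n → ℚ.≤-reflexive (h n))
                          (pointwise-≤ λ n → ℚ.≤-reflexive (sym (h n)))

≲-trans : ∀ {x y z} → x ≲ y → y ≲ z → x ≲ z
≲-trans {x} {y} {z} (mk≲ h) (mk≲ k) = mk≲ λ δ 0<δ →
  let N , p = h (½ ℚ.* δ) (halve-pos δ 0<δ)
      M , q = k (½ ℚ.* δ) (halve-pos δ 0<δ)
  in N ℕ.⊔ M , λ n N⊔M≤n → let open ℚ.≤-Reasoning in begin
    seq x n                                  ≤⟨ p n (ℕ.m⊔n≤o⇒m≤o N M N⊔M≤n) ⟩
    seq y n ℚ.+ ½ ℚ.* δ                      ≤⟨ ℚ.+-monoˡ-≤ (½ ℚ.* δ) (q n (ℕ.m⊔n≤o⇒n≤o N M N⊔M≤n)) ⟩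
    seq z n ℚ.+ ½ ℚ.* δ ℚ.+ ½ ℚ.* δ          ≡⟨ solve 2 (λ z d → z :+ con ½ :* d :+ con ½ :* d := z :+ d) refl (seq z n) δ ⟩
    seq z n ℚ.+ δ                            ∎
  where open +-*-Solver

infixl 6 _⊞_

-- Opaque, since unification would otherwise unfold the Cauchy moduli of sums.
opaque
  _⊞_ : ℝ → ℝ → ℝ
  _⊞_ = _+_

  +≡⊞ : ∀ {x y} → x + y ≡ x ⊞ y
  +≡⊞ = refl

  ⊞-mono-≲ : ∀ {x y u v} → x ≲ y → u ≲ v → x ⊞ u ≲ y ⊞ v
  ⊞-mono-≲ {x} {y} {u} {v} (mk≲ h) (mk≲ k) = mk≲ λ δ 0<δ →
    let N , p = h (½ ℚ.* δ) (halve-pos δ 0<δ)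
        M , q = k (½ ℚ.* δ) (halve-pos δ 0<δ)
    in N ℕ.⊔ M , λ n N⊔M≤n → let open ℚ.≤-Reasoning in begin
      seq x n ℚ.+ seq u n                                  ≤⟨ ℚ.+-mono-≤ (p n (ℕ.m⊔n≤o⇒m≤o N M N⊔M≤n)) (q n (ℕ.m⊔n≤o⇒n≤o N M N⊔M≤n)) ⟩
      (seq y n ℚ.+ ½ ℚ.* δ) ℚ.+ (seq v n ℚ.+ ½ ℚ.* δ)      ≡⟨ solve 3 (λ y v d → (y :+ con ½ :* d) :+ (v :+ con ½ :* d) := y :+ v :+ d) refl (seq y n) (seq v n) δ ⟩
      seq y n ℚ.+ seq v n ℚ.+ δ                            ∎
    where open +-*-Solver

  ⊞-cancelʳ-≲ : ∀ {x y} z → x ⊞ z ≲ y ⊞ z → x ≲ y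
  ⊞-cancelʳ-≲ {x} {y} z (mk≲ h) = mk≲ λ δ 0<δ → let N , p = h δ 0<δ in
    N , λ n N≤n → +-cancelʳ-≤ (seq z n) (subst (seq x n ℚ.+ seq z n ℚ.≤_)
      (solve 3 (λ y z d → (y :+ z) :+ d := (y :+ d) :+ z) refl (seq y n) (seq z n) δ) (p n N≤n))
    where open +-*-Solver

  -- Needed because potentials measure twice the weight of the edges in a class.
  halve-≲ : ∀ {x y} → x ⊞ x ≲ y ⊞ y → x ≲ y
  halve-≲ {x} {y} (mk≲ h) = mk≲ λ δ 0<δ →
    let N , p = h (δ ℚ.+ δ) (ℚ.+-mono-< 0<δ 0<δ)
    in N , λ n N≤n → ℚ.≮⇒≥ λ lt → ℚ.<-irrefl refl (ℚ.<-≤-trans (ℚ.+-mono-< lt lt) (subst (seq x n ℚ.+ seq x n ℚ.≤_)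
      (solve 2 (λ y d → (y :+ y) :+ (d :+ d) := (y :+ d) :+ (y :+ d)) refl (seq y n) δ) (p n N≤n)))
    where open +-*-Solver

  ⊞-assoc : ∀ x y z → (x ⊞ y) ⊞ z ≈ x ⊞ (y ⊞ z)
  ⊞-assoc x y z = pointwise-≡ λ n → ℚ.+-assoc (seq x n) (seq y n) (seq z n)

  ⊞-comm : ∀ x y → x ⊞ y ≈ y ⊞ x
  ⊞-comm x y = pointwise-≡ λ n → ℚ.+-comm (seq x n) (seq y n)

  ⊞-identityˡ : ∀ x → 0ℝ ⊞ x ≈ x
  ⊞-identityˡ x = pointwise-≡ λ n → ℚ.+-identityˡ (seq x n)

  ⊞-identityʳ : ∀ x → x ⊞ 0ℝ ≈ x
  ⊞-identityʳ x = pointwise-≡ λ n → ℚ.+-identityʳ (seq x n)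

-- One comparison of rationals suffices, at an index `N` beyond both Cauchy moduli: a gap of more
-- than 3η there would leave a gap of η at all later indices, against `x ≤ y`. Moving each sequence
-- between `N` and `n` costs one further η, so η is a fifth of δ.
≤⇒≲ : ∀ {x y} → x ≤ y → x ≲ y
≤⇒≲ {x} {y} x≤y = mk≲ λ δ 0<δ →
  let η = ⅕ ℚ.* δ
      0<η = fifth-pos δ 0<δ
      Nx , px = cauchy x η 0<η
      Ny , py = cauchy y η 0<η
      N = Nx ℕ.⊔ Ny
      closeˣ : ∀ m n → N ℕ.≤ m → N ℕ.≤ n → seq x m ℚ.≤ seq x n ℚ.+ η
      closeˣ m n N≤m N≤n = ∣p-q∣<δ⇒p≤q+δ (seq x m) (seq x n)
        (px m n (ℕ.m⊔n≤o⇒m≤o Nx Ny N≤m) (ℕ.m⊔n≤o⇒m≤o Nx Ny N≤n))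
      closeʸ : ∀ m n → N ℕ.≤ m → N ℕ.≤ n → seq y m ℚ.≤ seq y n ℚ.+ η
      closeʸ m n N≤m N≤n = ∣p-q∣<δ⇒p≤q+δ (seq y m) (seq y n)
        (py m n (ℕ.m⊔n≤o⇒n≤o Nx Ny N≤m) (ℕ.m⊔n≤o⇒n≤o Nx Ny N≤n))
      open ℚ.≤-Reasoning
      xN≤ : seq x N ℚ.≤ seq y N ℚ.+ (η ℚ.+ η ℚ.+ η)
      xN≤ = ℚ.≮⇒≥ λ lt → x≤y (η , 0<η , N , λ n N≤n →
        +-cancelʳ-≤ η (begin
          seq y n ℚ.+ η ℚ.+ η                 ≤⟨ ℚ.+-monoˡ-≤ η (ℚ.+-monoˡ-≤ η (closeʸ n N N≤n ℕ.≤-refl)) ⟩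
          seq y N ℚ.+ η ℚ.+ η ℚ.+ η           ≡⟨ solve 2 (λ y e → y :+ e :+ e :+ e := y :+ (e :+ e :+ e)) refl (seq y N) η ⟩
          seq y N ℚ.+ (η ℚ.+ η ℚ.+ η)         ≤⟨ ℚ.<⇒≤ lt ⟩
          seq x N                             ≤⟨ closeˣ N n ℕ.≤-refl N≤n ⟩
          seq x n ℚ.+ η                       ∎))
  in N , λ n N≤n → begin
    seq x n                                      ≤⟨ closeˣ n N N≤n ℕ.≤-refl ⟩
    seq x N ℚ.+ η                                ≤⟨ ℚ.+-monoˡ-≤ η xN≤ ⟩
    seq y N ℚ.+ (η ℚ.+ η ℚ.+ η) ℚ.+ η            ≤⟨ ℚ.+-monoˡ-≤ η (ℚ.+-monoˡ-≤ (η ℚ.+ η ℚ.+ η) (closeʸ N n ℕ.≤-refl N≤n)) ⟩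
    seq y n ℚ.+ η ℚ.+ (η ℚ.+ η ℚ.+ η) ℚ.+ η      ≡⟨ solve 2 (λ y d → let e = con ⅕ :* d in y :+ e :+ (e :+ e :+ e) :+ e := y :+ d) refl (seq y n) δ ⟩
    seq y n ℚ.+ δ                                ∎
  where open +-*-Solver

≲⇒≤ : ∀ {x y} → x ≲ y → x ≤ y
≲⇒≤ {x} {y} (mk≲ h) (δ , 0<δ , N , p) =
  let M , q = h (½ ℚ.* δ) (halve-pos δ 0<δ)
      n = N ℕ.⊔ M
  in ℚ.<-irrefl refl (ℚ.<-≤-trans (ℚ.+-monoʳ-< (seq y n) (halve-lt δ 0<δ))
       (ℚ.≤-trans (p n (ℕ.m≤m⊔n N M)) (q n (ℕ.m≤n⊔m N M))))

≲-refl : ∀ {x} → x ≲ x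
≲-refl = pointwise-≤ λ _ → ℚ.≤-refl

≈-refl : ∀ {x} → x ≈ x
≈-refl = pointwise-≡ λ _ → refl

≈-sym : ∀ {x y} → x ≈ y → y ≈ x
≈-sym {x} {y} (mk≈ h) = mk≈ λ δ 0<δ → let N , p = h δ 0<δ in
  N , λ n N≤n → subst (ℚ._< δ) (∣p-q∣≡∣q-p∣ (seq x n) (seq y n)) (p n N≤n)

≈⇒≳ : ∀ {x y} → x ≈ y → y ≲ x
≈⇒≳ = ≈⇒≲ ∘ ≈-sym

≈-trans : ∀ {x y z} → x ≈ y → y ≈ z → x ≈ z
≈-trans h k = ≲-antisym (≲-trans (≈⇒≲ h) (≈⇒≲ k)) (≲-trans (≈⇒≳ k) (≈⇒≳ h))

⊞-cong : ∀ {x y u v} → x ≈ y → u ≈ v → x ⊞ u ≈ y ⊞ v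
⊞-cong h k = ≲-antisym (⊞-mono-≲ (≈⇒≲ h) (≈⇒≲ k)) (⊞-mono-≲ (≈⇒≳ h) (≈⇒≳ k))

⊞-cancelʳ-≈ : ∀ {x y} z → x ⊞ z ≈ y ⊞ z → x ≈ y
⊞-cancelʳ-≈ z h = ≲-antisym (⊞-cancelʳ-≲ z (≈⇒≲ h)) (⊞-cancelʳ-≲ z (≈⇒≳ h))

⊞-0-commutativeMonoid : CommutativeMonoid 0ℓ 0ℓ
⊞-0-commutativeMonoid = record
  { Carrier = ℝ
  ; _≈_ = _≈_
  ; _∙_ = _⊞_
  ; ε = 0ℝ
  ; isCommutativeMonoid = record
    { isMonoid = record
      { isSemigroup = record
        { isMagma = record
          { isEquivalence = record { refl = ≈-refl ; sym = ≈-sym ; trans = ≈-trans }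
          ; ∙-cong = ⊞-cong
          }
        ; assoc = ⊞-assoc
        }
      ; identity = ⊞-identityˡ , ⊞-identityʳ
      }
    ; comm = ⊞-comm
    }
  }

≲-poset : Poset 0ℓ 0ℓ 0ℓ
≲-poset = record
  { Carrier = ℝ
  ; _≈_ = _≈_
  ; _≤_ = _≲_
  ; isPartialOrder = record
    { isPreorder = record
      { isEquivalence = record { refl = ≈-refl ; sym = ≈-sym ; trans = ≈-trans }
      ; reflexive = ≈⇒≲
      ; trans = ≲-trans
      }
    ; antisym = ≲-antisym
    }
  }

module ≲-Reasoning = PosetReasoning ≲-poset

module ⊞-Solver = CMSolver ⊞-0-commutativeMonoid

<⇒≲ : ∀ {x y} → x < y → x ≲ y
<⇒≲ {x} {y} (δ₀ , 0<δ₀ , N , p) = mk≲ λ δ 0<δ → N , λ n N≤n → begin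
  seq x n          ≡⟨ ℚ.+-identityʳ (seq x n) ⟨
  seq x n ℚ.+ 0ℚ   ≤⟨ ℚ.+-monoʳ-≤ (seq x n) (ℚ.<⇒≤ 0<δ₀) ⟩
  seq x n ℚ.+ δ₀   ≤⟨ p n N≤n ⟩
  seq y n          ≡⟨ ℚ.+-identityʳ (seq y n) ⟨
  seq y n ℚ.+ 0ℚ   ≤⟨ ℚ.+-monoʳ-≤ (seq y n) (ℚ.<⇒≤ 0<δ) ⟩
  seq y n ℚ.+ δ    ∎
  where open ℚ.≤-Reasoning

x≲x⊞y : ∀ x {y} → 0ℝ ≲ y → x ≲ x ⊞ y
x≲x⊞y x {y} 0≲y = ≲-trans (≈⇒≳ (⊞-identityʳ x)) (⊞-mono-≲ (≲-refl {x}) 0≲y)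

y≲x⊞y : ∀ {x} y → 0ℝ ≲ x → y ≲ x ⊞ y
y≲x⊞y {x} y 0≲x = ≲-trans (≈⇒≳ (⊞-identityˡ y)) (⊞-mono-≲ 0≲x (≲-refl {y}))

interchange : ∀ a b c d → (a ⊞ b) ⊞ (c ⊞ d) ≈ (a ⊞ c) ⊞ (b ⊞ d)
interchange a b c d = solve 4 (λ a b c d → ((a ⊕ b) ⊕ (c ⊕ d)) ⊜ ((a ⊕ c) ⊕ (b ⊕ d))) ≈-refl a b c d
  where open ⊞-Solver

-- Walks and products

module Walks (W : WeightedGraph) where
  open WeightedGraph W

  -- `w-sym` compares opposite orientations only, so it is used twice, through the reversed edge.
  w-cong : ∀ {u v u′ v′} (e : Adj u v) (e′ : Adj u′ v′) → u ≡ u′ → v ≡ v′ → w e ≈ w e′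
  w-cong e e′ refl refl = ≈-trans {y = w (adj-sym e)} (mk≈ (w-sym e (adj-sym e))) (mk≈ (w-sym (adj-sym e) e′))

  w-adj-sym : ∀ {u v} (e : Adj u v) → w (adj-sym e) ≈ w e
  w-adj-sym e = mk≈ (w-sym (adj-sym e) e)

  w-nonneg : ∀ {u v} (e : Adj u v) → 0ℝ ≲ w e
  w-nonneg e = <⇒≲ (w-pos e)

  w-≴0 : ∀ {u v} (e : Adj u v) → ¬ w e ≲ 0ℝ
  w-≴0 e h = ≲⇒≤ h (w-pos e)

  len : ∀ {u v} → Walk u v → ℝ
  len ε       = 0ℝ
  len (e ◅ p) = w e ⊞ len p

  len-nonneg : ∀ {u v} (p : Walk u v) → 0ℝ ≲ len p
  len-nonneg ε       = ≲-refl
  len-nonneg (e ◅ p) = ≲-trans (len-nonneg p) (y≲x⊞y (len p) (w-nonneg e))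

  len≡totalWeight : ∀ {u v} (p : Walk u v) → len p ≡ totalWeight p
  len≡totalWeight ε       = refl
  len≡totalWeight (e ◅ p) = trans (sym +≡⊞) (cong (w e +_) (len≡totalWeight p))

  len-◅◅ : ∀ {x y z} (p : Walk x y) (q : Walk y z) → len (p ◅◅ q) ≈ len p ⊞ len q
  len-◅◅ ε       q = ≈-sym (⊞-identityˡ (len q))
  len-◅◅ (e ◅ p) q = ≈-trans (⊞-cong ≈-refl (len-◅◅ p q)) (≈-sym (⊞-assoc (w e) (len p) (len q)))

  reverse : ∀ {x y} → Walk x y → Walk y x
  reverse ε       = ε
  reverse (e ◅ p) = reverse p ◅◅ (adj-sym e ◅ ε)

  len-reverse : ∀ {x y} (p : Walk x y) → len (reverse p) ≈ len p
  len-reverse ε       = ≈-refl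
  len-reverse (e ◅ p) = ≈-trans (len-◅◅ (reverse p) (adj-sym e ◅ ε)) (≈-trans
    (⊞-cong (len-reverse p) (≈-trans (⊞-identityʳ (w (adj-sym e))) (w-adj-sym e)))
    (⊞-comm (len p) (w e)))

  -- The test takes the adjacency proof because in a product the index of an edge is read off that
  -- proof.
  part : (∀ {u v} → Adj u v → Bool) → ∀ {u v} → Walk u v → ℝ
  part b ε       = 0ℝ
  part b (e ◅ p) = if b e then w e ⊞ part b p else part b p

  len-split : ∀ (b : ∀ {u v} → Adj u v → Bool) {u v} (p : Walk u v) →
              len p ≈ part b p ⊞ part (not ∘ b) p
  len-split b ε = ≈-sym (⊞-identityˡ 0ℝ)
  len-split b (e ◅ p) with b e
  ... | true  = ≈-trans (⊞-cong ≈-refl (len-split b p))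
                        (≈-sym (⊞-assoc (w e) (part b p) (part (not ∘ b) p)))
  ... | false = ≈-trans (⊞-cong ≈-refl (len-split b p))
    (solve 3 (λ a b c → (a ⊕ (b ⊕ c)) ⊜ (b ⊕ (a ⊕ c))) ≈-refl (w e) (part b p) (part (not ∘ b) p))
    where open ⊞-Solver

  part-nonneg : ∀ (b : ∀ {u v} → Adj u v → Bool) {u v} (p : Walk u v) → 0ℝ ≲ part b p
  part-nonneg b ε = ≲-refl
  part-nonneg b (e ◅ p) with b e
  ... | true  = ≲-trans (part-nonneg b p) (y≲x⊞y (part b p) (w-nonneg e))
  ... | false = part-nonneg b p

  part-◅◅ : ∀ (b : ∀ {u v} → Adj u v → Bool) {x y z} (p : Walk x y) (q : Walk y z) →
            part b (p ◅◅ q) ≈ part b p ⊞ part b q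
  part-◅◅ b ε       q = ≈-sym (⊞-identityˡ (part b q))
  part-◅◅ b (e ◅ p) q with b e
  ... | true  = ≈-trans (⊞-cong ≈-refl (part-◅◅ b p q)) (≈-sym (⊞-assoc (w e) (part b p) (part b q)))
  ... | false = part-◅◅ b p q

  record Geodesic (u v : V) (x : ℝ) : Set where
    constructor geodesic
    field
      walk     : Walk u v
      len≈     : len walk ≈ x
      shortest : ∀ (p : Walk u v) → x ≲ len p

  IsDistance⇒Geodesic : ∀ {u v x} → IsDistance u v x → Geodesic u v x
  IsDistance⇒Geodesic ((p , p≃x) , x≤) =
    geodesic p (subst (_≈ _) (sym (len≡totalWeight p)) (mk≈ p≃x))
               (λ q → subst (_ ≲_) (sym (len≡totalWeight q)) (≤⇒≲ (x≤ q)))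

  Geodesic⇒IsDistance : ∀ {u v x} → Geodesic u v x → IsDistance u v x
  Geodesic⇒IsDistance (geodesic p p≈x x≤) =
    (p , un≈ (subst (_≈ _) (len≡totalWeight p) p≈x))
    , (λ q → ≲⇒≤ (subst (_ ≲_) (len≡totalWeight q) (x≤ q)))

  geodesic-unique : ∀ {u v x y} → Geodesic u v x → Geodesic u v y → x ≈ y
  geodesic-unique (geodesic p p≈x x≤) (geodesic q q≈y y≤) =
    ≲-antisym (≲-trans (x≤ q) (≈⇒≲ q≈y)) (≲-trans (y≤ p) (≈⇒≲ p≈x))

  geodesic-cong : ∀ {u v x y} → x ≈ y → Geodesic u v x → Geodesic u v y
  geodesic-cong x≈y (geodesic p p≈x x≤) =
    geodesic p (≈-trans p≈x x≈y) (λ q → ≲-trans (≈⇒≳ x≈y) (x≤ q))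

  -- Distances are carried as data: those of `G` come from the isometry of a pseudofactorization,
  -- those of a factor from `factorMetric`. One inequality expresses minimality, as `d-edge` gives
  -- the other.
  record MinimalMetric : Set where
    field
      d       : V → V → ℝ
      isDist  : ∀ u v → Geodesic u v (d u v)
      minimal : ∀ {u v} (e : Adj u v) → w e ≲ d u v

    private module D u v = Geodesic (isDist u v)

    d-refl : ∀ u → d u u ≈ 0ℝ
    d-refl u = ≲-antisym (D.shortest u u ε)
      (≲-trans (len-nonneg (D.walk u u)) (≈⇒≲ (D.len≈ u u)))

    d-sym : ∀ u v → d u v ≈ d v u
    d-sym u v = ≲-antisym (half u v) (half v u)
      where
      half : ∀ u v → d u v ≲ d v u
      half u v = ≲-trans (D.shortest u v (reverse (D.walk v u)))
                         (≈⇒≲ (≈-trans (len-reverse (D.walk v u)) (D.len≈ v u)))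

    d-triangle : ∀ u v z → d u z ≲ d u v ⊞ d v z
    d-triangle u v z = ≲-trans (D.shortest u z (D.walk u v ◅◅ D.walk v z))
      (≈⇒≲ (≈-trans (len-◅◅ (D.walk u v) (D.walk v z)) (⊞-cong (D.len≈ u v) (D.len≈ v z))))

    d-edge : ∀ {u v} (e : Adj u v) → d u v ≲ w e
    d-edge {u} {v} e = ≲-trans (D.shortest u v (e ◅ ε)) (≈⇒≲ (⊞-identityʳ (w e)))

tabulate : ∀ {m} {A : Fin m → Set} → (∀ i → A i) → Tuple A
tabulate {zero}  f = tt
tabulate {suc m} f = f zero , tabulate (f ∘ suc)

lookup-tabulate : ∀ {m} {A : Fin m → Set} (f : ∀ i → A i) i → _!_ {A = A} (tabulate f) i ≡ f i
lookup-tabulate f zero    = refl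
lookup-tabulate f (suc i) = lookup-tabulate (f ∘ suc) i

tuple-ext : ∀ {m} {A : Fin m → Set} (x y : Tuple A) →
            (∀ i → _!_ {A = A} x i ≡ _!_ {A = A} y i) → x ≡ y
tuple-ext {zero}  tt tt _ = refl
tuple-ext {suc m} (x , xs) (y , ys) h = cong₂ _,_ (h zero) (tuple-ext xs ys (h ∘ suc))

module Product {m} (F : Fin m → Graph) where
  private
    module F i  = Graph (F i)
    module FW i = Walks (weighted (F i))
    module G*   = WeightedGraph (∏ F)
    module G*W  = Walks (∏ F)

  infixl 9 _‼_

  _‼_ : G*.V → ∀ i → F.V i
  x ‼ i = _!_ {A = λ i → F.V i} x i

  AgreeOff : Fin m → G*.V → G*.V → Set
  AgreeOff i x y = ∀ j → j ≢ i → x ‼ j ≡ y ‼ j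

  module _ (i : Fin m) (a : F.V i) (x : G*.V) where
    private
      entry : ∀ j → F.V j
      entry j with j Fin.≟ i
      ... | yes refl = a
      ... | no _     = x ‼ j

      entry-same : entry i ≡ a
      entry-same with i Fin.≟ i
      ... | yes refl = refl
      ... | no i≢i   = ⊥-elim (i≢i refl)

      entry-other : ∀ j → j ≢ i → entry j ≡ x ‼ j
      entry-other j j≢i with j Fin.≟ i
      ... | yes refl = ⊥-elim (j≢i refl)
      ... | no _     = refl

    update : G*.V
    update = tabulate entry

    update-same : update ‼ i ≡ a
    update-same = trans (lookup-tabulate entry i) entry-same

    update-other : AgreeOff i update x
    update-other j j≢i = trans (lookup-tabulate entry j) (entry-other j j≢i)

  on off : Fin m → ∀ {x y} → G*.Walk x y → ℝ
  on  i = G*W.part (λ e → does (i Fin.≟ proj₁ e))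
  off i = G*W.part (λ e → not (does (i Fin.≟ proj₁ e)))

  len≈on⊞off : ∀ i {x y} (p : G*.Walk x y) → G*W.len p ≈ on i p ⊞ off i p
  len≈on⊞off i = G*W.len-split (λ e → does (i Fin.≟ proj₁ e))

  project : ∀ i {x y} (p : G*.Walk x y) →
            Σ[ q ∈ F.Walk i (x ‼ i) (y ‼ i) ] FW.len i q ≈ on i p
  project i ε = ε , ≈-refl
  project i {y = y} ((ℓ , e , eq) ◅ p) with i Fin.≟ ℓ | project i p
  ... | yes refl | q , q≈ = e ◅ q , ⊞-cong ≈-refl q≈
  ... | no i≢ℓ   | q , q≈ =
    subst (λ a → Σ[ q ∈ F.Walk i a (y ‼ i) ] FW.len i q ≈ on i p) (sym (eq i i≢ℓ)) (q , q≈)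

  lift : ∀ i {a b} (q : F.Walk i a b) {x y} → x ‼ i ≡ a → y ‼ i ≡ b → AgreeOff i x y →
         Σ[ r ∈ G*.Walk x y ] G*W.len r ≈ FW.len i q
  lift i ε {x} {y} xᵢ yᵢ x~y with tuple-ext x y same
    where
    same : ∀ j → x ‼ j ≡ y ‼ j
    same j with j Fin.≟ i
    ... | yes refl = trans xᵢ (sym yᵢ)
    ... | no j≢i   = x~y j j≢i
  ... | refl = ε , ≈-refl
  lift i {a} (_◅_ {j = c} e q) {x} {y} xᵢ yᵢ x~y =
    let z = update i c x
        zᵢ = update-same i c x
        z~x = update-other i c x
        r , r≈ = lift i q {z} {y} zᵢ yᵢ (λ j j≢i → trans (z~x j j≢i) (x~y j j≢i))
        e′ = subst₂ (F.Adj i) (sym xᵢ) (sym zᵢ) e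
    in (i , e′ , λ j j≢i → sym (z~x j j≢i)) ◅ r , ⊞-cong (FW.w-cong i e′ e xᵢ zᵢ) r≈

  -- Follow the steps of p off coordinate i, and replace those in coordinate i by q.
  combine : ∀ i {x y x′ y′} (p : G*.Walk x y) {a b} (q : F.Walk i a b) →
            x′ ‼ i ≡ a → y′ ‼ i ≡ b → AgreeOff i x′ x → AgreeOff i y′ y →
            Σ[ r ∈ G*.Walk x′ y′ ] G*W.len r ≈ FW.len i q ⊞ off i p
  -- All of `q` is walked at the end, when the other coordinates have reached their final values.
  combine i ε q x′ᵢ y′ᵢ x′~x y′~y =
    let r , r≈ = lift i q x′ᵢ y′ᵢ (λ j j≢i → trans (x′~x j j≢i) (sym (y′~y j j≢i)))
    in r , ≈-trans r≈ (≈-sym (⊞-identityʳ (FW.len i q)))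
  combine i {x} {y} {x′} {y′} (_◅_ {j = z} (ℓ , e , eq) p) q x′ᵢ y′ᵢ x′~x y′~y with i Fin.≟ ℓ
  ... | yes refl = combine i p q x′ᵢ y′ᵢ (λ j j≢i → trans (x′~x j j≢i) (eq j j≢i)) y′~y
  ... | no i≢ℓ   =
    let z′ = update i (x′ ‼ i) z
        z′ᵢ = update-same i (x′ ‼ i) z
        z′~z = update-other i (x′ ‼ i) z
        ℓ≢i = λ ℓ≡i → i≢ℓ (sym ℓ≡i)
        e′ = subst₂ (F.Adj ℓ) (sym (x′~x ℓ ℓ≢i)) (sym (z′~z ℓ ℓ≢i)) e
        r , r≈ = combine i {x′ = z′} p q (trans z′ᵢ x′ᵢ) y′ᵢ z′~z y′~y
        same : ∀ j → j ≢ ℓ → x′ ‼ j ≡ z′ ‼ j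
        same j j≢ℓ = agree j j≢ℓ (j Fin.≟ i)
    in (ℓ , e′ , same) ◅ r , ≈-trans
         (⊞-cong (FW.w-cong ℓ e′ e (x′~x ℓ ℓ≢i) (z′~z ℓ ℓ≢i)) r≈)
         (solve 3 (λ a b c → (a ⊕ (b ⊕ c)) ⊜ (b ⊕ (a ⊕ c))) ≈-refl (F.w ℓ e) (FW.len i q) (off i p))
    where
    open ⊞-Solver
    agree : ∀ j → j ≢ ℓ → Dec (j ≡ i) → x′ ‼ j ≡ update i (x′ ‼ i) z ‼ j
    agree j j≢ℓ (yes refl) = sym (update-same i (x′ ‼ i) z)
    agree j j≢ℓ (no j≢i)   =
      trans (x′~x j j≢i) (trans (eq j j≢ℓ) (sym (update-other i (x′ ‼ i) z j j≢i)))

-- Coordinates of a pseudofactorization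

module Factorization
  (G : Graph) (M : Walks.MinimalMetric (weighted G))
  {m} (F : Fin m → Graph) (P : Pseudofactorization G F)
  where

  open Walks.MinimalMetric M
  open Pseudofactorization P
  open Product F
  private
    module G    = Graph G
    module GW   = Walks (weighted G)
    module F i  = Graph (F i)
    module FW i = Walks (weighted (F i))
    module G*   = WeightedGraph (∏ F)
    module G*W  = Walks (∏ F)

  isometry : ∀ u v → G*W.Geodesic (π u) (π v) (d u v)
  isometry u v =
    let x , x-in-G , x-in-G* = isometric u v
    in G*W.geodesic-cong (GW.geodesic-unique (GW.IsDistance⇒Geodesic {x = x} x-in-G) (isDist u v))
                         (G*W.IsDistance⇒Geodesic {x = x} x-in-G*)

  private
    module I u v = G*W.Geodesic (isometry u v)

  -- Exchanging the `i`-steps of `p` for `q` gives a walk between the same ends, which cannot be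
  -- shorter than `p`; the common part `off i p` cancels.
  on-shortest : ∀ i {u v} (p : G*.Walk (π u) (π v)) → G*W.len p ≲ d u v →
                ∀ (q : F.Walk i (π u ‼ i) (π v ‼ i)) → on i p ≲ FW.len i q
  on-shortest i {u} {v} p p≲d q =
    let r , r≈ = combine i {x′ = π u} {y′ = π v} p q refl refl (λ _ _ → refl) (λ _ _ → refl)
    in ⊞-cancelʳ-≲ (off i p) (begin
      on i p ⊞ off i p       ≈⟨ len≈on⊞off i p ⟨
      G*W.len p              ≤⟨ p≲d ⟩
      d u v                  ≤⟨ I.shortest u v r ⟩
      G*W.len r              ≈⟨ r≈ ⟩
      FW.len i q ⊞ off i p   ∎)
    where open ≲-Reasoning

  private
    on-geodesic : ∀ i u v → FW.Geodesic i (π u ‼ i) (π v ‼ i) (on i (I.walk u v))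
    on-geodesic i u v =
      let q , q≈ = project i (I.walk u v)
      in Walks.geodesic q q≈ (on-shortest i (I.walk u v) (≈⇒≲ (I.len≈ u v)))

    preimage : ∀ i → F.V i → G.V
    preimage i a = proj₁ (vertices-covered i a)

  -- The distance of the factor, realised by projecting a geodesic between the images of chosen
  -- preimages. By uniqueness of distances the choice is immaterial up to `_≈_`.
  D : ∀ i → F.V i → F.V i → ℝ
  D i a b = on i (I.walk (preimage i a) (preimage i b))

  D-isDist : ∀ i a b → FW.Geodesic i a b (D i a b)
  D-isDist i a b = subst₂ (λ x y → FW.Geodesic i x y (D i a b))
    (proj₂ (vertices-covered i a)) (proj₂ (vertices-covered i b))
    (on-geodesic i (preimage i a) (preimage i b))

  -- The contribution of the coordinates other than `i`; `R-cong` shows that it depends on those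
  -- coordinates alone.
  R : Fin m → G.V → G.V → ℝ
  R i u v = off i (I.walk u v)

  d≈D⊞R : ∀ i u v → d u v ≈ D i (π u ‼ i) (π v ‼ i) ⊞ R i u v
  d≈D⊞R i u v = begin-equality
    d u v                                      ≈⟨ I.len≈ u v ⟨
    G*W.len (I.walk u v)                       ≈⟨ len≈on⊞off i (I.walk u v) ⟩
    on i (I.walk u v) ⊞ R i u v                ≈⟨ ⊞-cong (FW.geodesic-unique i (on-geodesic i u v) (D-isDist i _ _)) ≈-refl ⟩
    D i (π u ‼ i) (π v ‼ i) ⊞ R i u v          ∎
    where open ≲-Reasoning

  SameOff : Fin m → G.V → G.V → Set
  SameOff i u v = AgreeOff i (π u) (π v)

  sameOff-sym : ∀ i {u v} → SameOff i u v → SameOff i v u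
  sameOff-sym i h j j≢i = sym (h j j≢i)

  R-cong : ∀ i {u v u′ v′} → SameOff i u u′ → SameOff i v v′ → R i u v ≈ R i u′ v′
  R-cong i u~ v~ = ≲-antisym (R-mono u~ v~) (R-mono (sameOff-sym i u~) (sameOff-sym i v~))
    where
    open ≲-Reasoning
    R-mono : ∀ {u v u′ v′} → SameOff i u u′ → SameOff i v v′ → R i u v ≲ R i u′ v′
    R-mono {u} {v} {u′} {v′} u~ v~ =
      -- The walk `r` takes its `i`-steps from the geodesic for u, v and its other steps from the
      -- one for u′, v′. It joins `π u` to `π v`, so it is no shorter than `p`.
      let p = I.walk u v
          q , q≈ = project i p
          r , r≈ = combine i {x′ = π u} {y′ = π v} (I.walk u′ v′) q refl refl u~ v~
      in ⊞-cancelʳ-≲ (on i p) (begin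
        off i p ⊞ on i p              ≈⟨ ⊞-comm (off i p) (on i p) ⟩
        on i p ⊞ off i p              ≈⟨ len≈on⊞off i p ⟨
        G*W.len p                     ≈⟨ I.len≈ u v ⟩
        d u v                         ≤⟨ I.shortest u v r ⟩
        G*W.len r                     ≈⟨ r≈ ⟩
        FW.len i q ⊞ R i u′ v′        ≈⟨ ⊞-cong q≈ ≈-refl ⟩
        on i p ⊞ R i u′ v′            ≈⟨ ⊞-comm (on i p) (R i u′ v′) ⟩
        R i u′ v′ ⊞ on i p            ∎)

  -- In the decomposition `d≈D⊞R`, exchanging x and y does not affect the `D` terms, and exchanging
  -- u and v does not affect the `R` terms. For adjacent u and v this is the orthogonality of an
  -- edge with index `i` to one with another index.
  orthogonal : ∀ i {u v x y} → SameOff i u v → π x ‼ i ≡ π y ‼ i →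
               d u x ⊞ d v y ≈ d u y ⊞ d v x
  orthogonal i {u} {v} {x} {y} u~v x≡y = begin-equality
    d u x ⊞ d v y
      ≈⟨ ⊞-cong (d≈D⊞R i u x) (d≈D⊞R i v y) ⟩
    (D i (π u ‼ i) (π x ‼ i) ⊞ R i u x) ⊞ (D i (π v ‼ i) (π y ‼ i) ⊞ R i v y)
      ≈⟨ ⊞-cong (⊞-cong (D-congʳ (π u ‼ i) x≡y) (R-cong i u~v (λ _ _ → refl)))
                (⊞-cong (D-congʳ (π v ‼ i) (sym x≡y)) (R-cong i (sameOff-sym i u~v) (λ _ _ → refl))) ⟩
    (D i (π u ‼ i) (π y ‼ i) ⊞ R i v x) ⊞ (D i (π v ‼ i) (π x ‼ i) ⊞ R i u y)
      ≈⟨ solve 4 (λ a b c d → ((a ⊕ b) ⊕ (c ⊕ d)) ⊜ ((a ⊕ d) ⊕ (c ⊕ b))) ≈-refl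
           (D i (π u ‼ i) (π y ‼ i)) (R i v x) (D i (π v ‼ i) (π x ‼ i)) (R i u y) ⟩
    (D i (π u ‼ i) (π y ‼ i) ⊞ R i u y) ⊞ (D i (π v ‼ i) (π x ‼ i) ⊞ R i v x)
      ≈⟨ ⊞-cong (d≈D⊞R i u y) (d≈D⊞R i v x) ⟨
    d u y ⊞ d v x ∎
    where
    open ≲-Reasoning
    open ⊞-Solver
    D-congʳ : ∀ a {b c} → b ≡ c → D i a b ≈ D i a c
    D-congʳ a refl = ≈-refl

  -- All four distances have the same remainder ρ, which cancels.
  orthogonal-project : ∀ i {u v x y} → SameOff i u v → SameOff i x y →
    d u x ⊞ d v y ≈ d u y ⊞ d v x →
    D i (π u ‼ i) (π x ‼ i) ⊞ D i (π v ‼ i) (π y ‼ i) ≈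
    D i (π u ‼ i) (π y ‼ i) ⊞ D i (π v ‼ i) (π x ‼ i)
  orthogonal-project i {u} {v} {x} {y} u~v x~y h =
    ⊞-cancelʳ-≈ (ρ ⊞ ρ) (begin-equality
      (D′ u x ⊞ D′ v y) ⊞ (ρ ⊞ ρ)     ≈⟨ expand u x v y (λ _ _ → refl) (λ _ _ → refl) u~v x~y ⟨
      d u x ⊞ d v y                   ≈⟨ h ⟩
      d u y ⊞ d v x                   ≈⟨ expand u y v x (λ _ _ → refl) x~y u~v (λ _ _ → refl) ⟩
      (D′ u y ⊞ D′ v x) ⊞ (ρ ⊞ ρ)     ∎)
    where
    open ≲-Reasoning
    open ⊞-Solver
    ρ = R i u x
    D′ : G.V → G.V → ℝ
    D′ a b = D i (π a ‼ i) (π b ‼ i)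
    expand : ∀ a b a′ b′ → SameOff i u a → SameOff i x b → SameOff i u a′ → SameOff i x b′ →
             d a b ⊞ d a′ b′ ≈ (D′ a b ⊞ D′ a′ b′) ⊞ (ρ ⊞ ρ)
    expand a b a′ b′ a~ b~ a′~ b′~ = ≈-trans
      (⊞-cong (≈-trans (d≈D⊞R i a b) (⊞-cong ≈-refl (≈-sym (R-cong i a~ b~))))
              (≈-trans (d≈D⊞R i a′ b′) (⊞-cong ≈-refl (≈-sym (R-cong i a′~ b′~)))))
      (solve 3 (λ p q r → ((p ⊕ r) ⊕ (q ⊕ r)) ⊜ ((p ⊕ q) ⊕ (r ⊕ r))) ≈-refl (D′ a b) (D′ a′ b′) ρ)

  -- The index is expressed through coordinates, so that it does not depend on the adjacency proof
  -- that `edges` returns.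
  EdgeAt : Fin m → G.V → G.V → Set
  EdgeAt i u v = G.Adj u v × π u ‼ i ≢ π v ‼ i

  edge-index : ∀ {u v} → G.Adj u v → ∃[ i ] EdgeAt i u v
  edge-index {u} {v} e = let (ℓ , e* , _) , _ = edges e in
    ℓ , e , λ eq → F.adj-irrefl ℓ (subst (F.Adj ℓ (π u ‼ ℓ)) (sym eq) e*)

  record ParentEdge (i : Fin m) {u v} (e : G.Adj u v) : Set where
    field
      parent   : F.Adj i (π u ‼ i) (π v ‼ i)
      w-parent : G.w e ≈ F.w i parent
      same-off : SameOff i u v

  open ParentEdge public

  parentEdge : ∀ {i u v} ((e , _) : EdgeAt i u v) → ParentEdge i e
  parentEdge {i} (e , u≢v) with edges e
  ... | (ℓ , e* , eq) , w≃ with i Fin.≟ ℓ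
  ... | yes refl = record { parent = e* ; w-parent = mk≈ w≃ ; same-off = eq }
  ... | no i≢ℓ   = ⊥-elim (u≢v (eq i i≢ℓ))

  edgeAt-unique : ∀ {i j u v} → EdgeAt i u v → EdgeAt j u v → i ≡ j
  edgeAt-unique {i} {j} eᵢ (_ , u≢v) with j Fin.≟ i
  ... | yes j≡i = sym j≡i
  ... | no j≢i  = ⊥-elim (u≢v (same-off (parentEdge eᵢ) j j≢i))

  -- The edge is the parent of some edge of `G`, which is a geodesic by minimality. Its image is a
  -- shortest walk of one step in the product, so `on-shortest` applies.
  D-minimal : ∀ i {a b} (e : F.Adj i a b) → F.w i e ≲ D i a b
  D-minimal i e with edges-covered i e
  ... | u , v , e′ , u≢v , refl , refl =
    let E = parentEdge (e′ , u≢v)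
        p = (i , parent E , same-off E) ◅ ε
        p≲d = begin
          F.w i (parent E) ⊞ 0ℝ   ≈⟨ ⊞-identityʳ (F.w i (parent E)) ⟩
          F.w i (parent E)        ≈⟨ w-parent E ⟨
          G.w e′                  ≤⟨ minimal e′ ⟩
          d u v                   ∎
        q = D-isDist i (π u ‼ i) (π v ‼ i)
    in begin
      F.w i e                              ≈⟨ FW.w-cong i e (parent E) refl refl ⟩
      F.w i (parent E)                     ≤⟨ w≲on (parent E) (same-off E) ⟩
      on i p                               ≤⟨ on-shortest i p p≲d (Walks.Geodesic.walk q) ⟩
      FW.len i (Walks.Geodesic.walk q)     ≈⟨ Walks.Geodesic.len≈ q ⟩
      D i (π u ‼ i) (π v ‼ i)              ∎
    where
    open ≲-Reasoning
    w≲on : ∀ {x y} (e* : F.Adj i (x ‼ i) (y ‼ i)) (x~y : AgreeOff i x y) →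
           F.w i e* ≲ on i {x} {y} ((i , e* , x~y) ◅ ε)
    w≲on e* _ with i Fin.≟ i
    ... | yes refl = ≈⇒≳ (⊞-identityʳ (F.w i e*))
    ... | no i≢i   = ⊥-elim (i≢i refl)

  factorMetric : ∀ i → FW.MinimalMetric i
  factorMetric i = record { d = D i ; isDist = D-isDist i ; minimal = D-minimal i }

  push : ∀ {u v} → G.Walk u v → G*.Walk (π u) (π v)
  push ε       = ε
  push (e ◅ p) = proj₁ (edges e) ◅ push p

  len-push : ∀ {u v} (p : G.Walk u v) → G*W.len (push p) ≈ GW.len p
  len-push ε       = ≈-refl
  len-push (e ◅ p) = ⊞-cong (≈-sym (mk≈ (proj₂ (edges e)))) (len-push p)

  -- Weights being positive, on i (push p) ≲ 0ℝ says that no edge of p has index i.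
  same-coordinate⇒avoids : ∀ i {u v} → π u ‼ i ≡ π v ‼ i →
    Σ[ p ∈ G.Walk u v ] on i (push p) ≲ 0ℝ
  same-coordinate⇒avoids i {u} {v} u≡v =
    p , ≲-trans (on-shortest i (push p) (≈⇒≲ (≈-trans (len-push p) (Walks.Geodesic.len≈ (isDist u v)))) (proj₁ q))
                (≈⇒≲ (proj₂ q))
    where
    p = Walks.Geodesic.walk (isDist u v)
    trivial : ∀ {a b} → a ≡ b → Σ[ q ∈ F.Walk i a b ] FW.len i q ≈ 0ℝ
    trivial refl = ε , ≈-refl
    q = trivial u≡v

  avoids-head : ∀ i {u v z} (e : G.Adj u v) (p : G.Walk v z) → on i (push (e ◅ p)) ≲ 0ℝ →
                π u ‼ i ≡ π v ‼ i × on i (push p) ≲ 0ℝ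
  avoids-head i e p h with edges e
  ... | (ℓ , e* , eq) , _ with i Fin.≟ ℓ
  ... | no i≢ℓ   = eq i i≢ℓ , h
  ... | yes refl = ⊥-elim (FW.w-≴0 i e* (≲-trans
    (x≲x⊞y (F.w i e*) (G*W.part-nonneg (λ f → does (i Fin.≟ proj₁ f)) (push p))) h))

-- Edge classes orthogonal to their complements

record OrthogonalClass (K : WeightedGraph) (M : Walks.MinimalMetric K) : Set₁ where
  open WeightedGraph K
  open Walks.MinimalMetric M
  field
    S     : V → V → Set
    S?    : ∀ u v → Dec (S u v)
    S-sym : ∀ {u v} → S u v → S v u
    orth  : ∀ {a b x y} → Adj a b → S a b → Adj x y → ¬ S x y →
            d a x ⊞ d b y ≈ d a y ⊞ d b x

complement : ∀ {K M} → OrthogonalClass K M → OrthogonalClass K M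
complement {K} {M} C = record
  { S     = λ u v → ¬ S u v
  ; S?    = λ u v → ¬? (S? u v)
  ; S-sym = λ ¬s → ¬s ∘ S-sym
  ; orth  = λ {a} {b} {x} {y} e ¬s f ¬¬s →
      ≈-trans (⊞-cong (d-sym a x) (d-sym b y))
      (≈-trans (orth f (decidable-stable (S? x y) ¬¬s) e ¬s)
      (≈-trans (⊞-comm (d x b) (d y a)) (⊞-cong (d-sym y a) (d-sym x b))))
  }
  where
  open OrthogonalClass C
  open Walks.MinimalMetric M

module EdgeClass {K : WeightedGraph} {M : Walks.MinimalMetric K} (C : OrthogonalClass K M) where

  open WeightedGraph K
  open Walks K
  open MinimalMetric M
  open OrthogonalClass C
  open ≲-Reasoning
  open ⊞-Solver

  inS : ∀ {u v} → Adj u v → Bool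
  inS {u} {v} _ = does (S? u v)

  S-len : ∀ {u v} → Walk u v → ℝ
  S-len = part inS

  -- The potential of p at x is heads p x − tails p x.  It is constant along edges
  -- outside S and, by the triangle inequality, changes by at most 2 w f along an edge
  -- f of S; between the ends of a geodesic p it drops by exactly 2 S-len p.  Below,
  -- terms are moved across so that no subtraction occurs.
  tails heads : ∀ {a b} → Walk a b → V → ℝ
  tails ε x = 0ℝ
  tails (_◅_ {a} {c} e p) x with S? a c
  ... | yes _ = d a x ⊞ tails p x
  ... | no _  = tails p x
  heads ε x = 0ℝ
  heads (_◅_ {a} {c} e p) x with S? a c
  ... | yes _ = d c x ⊞ heads p x
  ... | no _  = heads p x

  -- For each edge ac of `p` in `S`, orthogonality to xy says that d c - d a takes the same value at
  -- x and at y.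
  potential-off : ∀ {a b x y} (p : Walk a b) → Adj x y → ¬ S x y →
                  heads p x ⊞ tails p y ≈ heads p y ⊞ tails p x
  potential-off ε f ¬s = ≈-refl
  potential-off {x = x} {y} (_◅_ {a} {c} e p) f ¬s with S? a c
  ... | no _  = potential-off p f ¬s
  ... | yes s = begin-equality
    (d c x ⊞ heads p x) ⊞ (d a y ⊞ tails p y)
      ≈⟨ solve 4 (λ h₁ h t₁ t → ((h₁ ⊕ h) ⊕ (t₁ ⊕ t)) ⊜ ((t₁ ⊕ h₁) ⊕ (h ⊕ t))) ≈-refl (d c x) (heads p x) (d a y) (tails p y) ⟩
    (d a y ⊞ d c x) ⊞ (heads p x ⊞ tails p y)
      ≈⟨ ⊞-cong (≈-sym (orth e s f ¬s)) (potential-off p f ¬s) ⟩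
    (d a x ⊞ d c y) ⊞ (heads p y ⊞ tails p x)
      ≈⟨ solve 4 (λ t₁ h₁ h t → ((t₁ ⊕ h₁) ⊕ (h ⊕ t)) ⊜ ((h₁ ⊕ h) ⊕ (t₁ ⊕ t))) ≈-refl (d a x) (d c y) (heads p y) (tails p x) ⟩
    (d c y ⊞ heads p y) ⊞ (d a x ⊞ tails p x) ∎

  -- Summed over all edges of `p`, head distance minus tail distance telescopes to d b - d a. Edges
  -- of `p` outside `S` are orthogonal to xy and contribute equally at x and y, so the edges in `S`
  -- account for the whole change of d b - d a.
  potential-on : ∀ {a b x y} (p : Walk a b) → Adj x y → S x y →
                 (heads p x ⊞ tails p y) ⊞ (d a x ⊞ d b y) ≈ (heads p y ⊞ tails p x) ⊞ (d a y ⊞ d b x)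
  potential-on {a} {x = x} {y} ε f s = ⊞-cong ≈-refl (⊞-comm (d a x) (d a y))
  potential-on {b = b} {x} {y} (_◅_ {a} {c} e p) f s with S? a c
  ... | yes _ = begin-equality
    ((d c x ⊞ heads p x) ⊞ (d a y ⊞ tails p y)) ⊞ (d a x ⊞ d b y)
      ≈⟨ solve 6 (λ cx h ay t ax by → (((cx ⊕ h) ⊕ (ay ⊕ t)) ⊕ (ax ⊕ by)) ⊜ (((h ⊕ t) ⊕ (cx ⊕ by)) ⊕ (ax ⊕ ay)))
           ≈-refl (d c x) (heads p x) (d a y) (tails p y) (d a x) (d b y) ⟩
    ((heads p x ⊞ tails p y) ⊞ (d c x ⊞ d b y)) ⊞ (d a x ⊞ d a y)
      ≈⟨ ⊞-cong (potential-on p f s) ≈-refl ⟩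
    ((heads p y ⊞ tails p x) ⊞ (d c y ⊞ d b x)) ⊞ (d a x ⊞ d a y)
      ≈⟨ solve 6 (λ cy h ax t ay bx → (((h ⊕ t) ⊕ (cy ⊕ bx)) ⊕ (ax ⊕ ay)) ⊜ (((cy ⊕ h) ⊕ (ax ⊕ t)) ⊕ (ay ⊕ bx)))
           ≈-refl (d c y) (heads p y) (d a x) (tails p x) (d a y) (d b x) ⟩
    ((d c y ⊞ heads p y) ⊞ (d a x ⊞ tails p x)) ⊞ (d a y ⊞ d b x) ∎
  ... | no ¬s = ⊞-cancelʳ-≈ (d c x ⊞ d c y) (begin-equality
    ((heads p x ⊞ tails p y) ⊞ (d a x ⊞ d b y)) ⊞ (d c x ⊞ d c y)
      ≈⟨ solve 5 (λ h ax by cx cy → ((h ⊕ (ax ⊕ by)) ⊕ (cx ⊕ cy)) ⊜ ((h ⊕ (cx ⊕ by)) ⊕ (ax ⊕ cy)))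
           ≈-refl (heads p x ⊞ tails p y) (d a x) (d b y) (d c x) (d c y) ⟩
    ((heads p x ⊞ tails p y) ⊞ (d c x ⊞ d b y)) ⊞ (d a x ⊞ d c y)
      ≈⟨ ⊞-cong (potential-on p f s) (begin-equality
           d a x ⊞ d c y    ≈⟨ ⊞-cong (d-sym a x) (d-sym c y) ⟩
           d x a ⊞ d y c    ≈⟨ orth f s e ¬s ⟩
           d x c ⊞ d y a    ≈⟨ ⊞-cong (d-sym x c) (d-sym y a) ⟩
           d c x ⊞ d a y    ∎) ⟩
    ((heads p y ⊞ tails p x) ⊞ (d c y ⊞ d b x)) ⊞ (d c x ⊞ d a y)
      ≈⟨ solve 5 (λ h cy bx cx ay → ((h ⊕ (cy ⊕ bx)) ⊕ (cx ⊕ ay)) ⊜ ((h ⊕ (ay ⊕ bx)) ⊕ (cx ⊕ cy)))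
           ≈-refl (heads p y ⊞ tails p x) (d c y) (d b x) (d c x) (d a y) ⟩
    ((heads p y ⊞ tails p x) ⊞ (d a y ⊞ d b x)) ⊞ (d c x ⊞ d c y) ∎)

  -- By `potential-on` the change is (d a y - d a x) + (d b x - d b y), and each bracket is at most
  -- `w f`.
  potential-step : ∀ {a b x y} (p : Walk a b) (f : Adj x y) → S x y →
    heads p x ⊞ tails p y ≲ (heads p y ⊞ tails p x) ⊞ (w f ⊞ w f)
  potential-step {a} {b} {x} {y} p f s = ⊞-cancelʳ-≲ (d a x ⊞ d b y) (begin
    (heads p x ⊞ tails p y) ⊞ (d a x ⊞ d b y)
      ≈⟨ potential-on p f s ⟩
    (heads p y ⊞ tails p x) ⊞ (d a y ⊞ d b x)
      ≤⟨ ⊞-mono-≲ ≲-refl (⊞-mono-≲ (≲-trans (d-triangle a x y) (⊞-mono-≲ ≲-refl (d-edge f)))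
           (≲-trans (d-triangle b y x) (⊞-mono-≲ ≲-refl (≲-trans (≈⇒≲ (d-sym y x)) (d-edge f))))) ⟩
    (heads p y ⊞ tails p x) ⊞ ((d a x ⊞ w f) ⊞ (d b y ⊞ w f))
      ≈⟨ solve 4 (λ h ax by w → (h ⊕ ((ax ⊕ w) ⊕ (by ⊕ w))) ⊜ ((h ⊕ (w ⊕ w)) ⊕ (ax ⊕ by)))
           ≈-refl (heads p y ⊞ tails p x) (d a x) (d b y) (w f) ⟩
    ((heads p y ⊞ tails p x) ⊞ (w f ⊞ w f)) ⊞ (d a x ⊞ d b y) ∎)

  private
    -- The values at z cancel when the bounds for the stretches from x to z and from z to y are
    -- added.
    chain : ∀ {hx hy hz tx ty tz c s} →
            hx ⊞ tz ≲ (hz ⊞ tx) ⊞ (c ⊞ c) → hz ⊞ ty ≲ (hy ⊞ tz) ⊞ (s ⊞ s) →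
            hx ⊞ ty ≲ (hy ⊞ tx) ⊞ ((c ⊞ s) ⊞ (c ⊞ s))
    chain {hx} {hy} {hz} {tx} {ty} {tz} {c} {s} h k = ⊞-cancelʳ-≲ (hz ⊞ tz) (begin
      (hx ⊞ ty) ⊞ (hz ⊞ tz)
        ≈⟨ solve 4 (λ a b c d → ((a ⊕ b) ⊕ (c ⊕ d)) ⊜ ((a ⊕ d) ⊕ (c ⊕ b))) ≈-refl hx ty hz tz ⟩
      (hx ⊞ tz) ⊞ (hz ⊞ ty)
        ≤⟨ ⊞-mono-≲ h k ⟩
      ((hz ⊞ tx) ⊞ (c ⊞ c)) ⊞ ((hy ⊞ tz) ⊞ (s ⊞ s))
        ≈⟨ solve 6 (λ hz tx c hy tz s → (((hz ⊕ tx) ⊕ (c ⊕ c)) ⊕ ((hy ⊕ tz) ⊕ (s ⊕ s))) ⊜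
                                        (((hy ⊕ tx) ⊕ ((c ⊕ s) ⊕ (c ⊕ s))) ⊕ (hz ⊕ tz)))
             ≈-refl hz tx c hy tz s ⟩
      ((hy ⊞ tx) ⊞ ((c ⊞ s) ⊞ (c ⊞ s))) ⊞ (hz ⊞ tz) ∎)

  potential-lipschitz : ∀ {a b x y} (p : Walk a b) (q : Walk x y) →
    heads p x ⊞ tails p y ≲ (heads p y ⊞ tails p x) ⊞ (S-len q ⊞ S-len q)
  potential-lipschitz p ε = x≲x⊞y _ (≈⇒≳ (⊞-identityˡ 0ℝ))
  potential-lipschitz p (_◅_ {x} {z} f q) with S? x z
  ... | yes s = chain (potential-step p f s) (potential-lipschitz p q)
  -- Here `chain` is used with `c` equal to `0ℝ`.
  ... | no ¬s = ≲-trans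
    (chain (≲-trans (≈⇒≲ (potential-off p f ¬s)) (x≲x⊞y _ (≈⇒≳ (⊞-identityˡ 0ℝ)))) (potential-lipschitz p q))
    (⊞-mono-≲ ≲-refl (⊞-mono-≲ (≈⇒≲ (⊞-identityˡ (S-len q))) (≈⇒≲ (⊞-identityˡ (S-len q)))))

  -- `tight` makes `e ◅ p` a final segment of a geodesic from u to v, so the triangle inequalities
  -- along it are equalities: compared with a, the vertex c is farther from u and closer to v by
  -- exactly `w e`.
  module _ {u v a c} (e : Adj a c) (p : Walk c v) (tight : d u a ⊞ (w e ⊞ len p) ≲ d u v) where
    private
      shortest : d c v ≲ len p
      shortest = Geodesic.shortest (isDist c v) p

    tight-tail : d u c ⊞ len p ≲ d u v
    tight-tail = begin
      d u c ⊞ len p             ≤⟨ ⊞-mono-≲ (≲-trans (d-triangle u a c) (⊞-mono-≲ ≲-refl (d-edge e))) ≲-refl ⟩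
      (d u a ⊞ w e) ⊞ len p     ≈⟨ ⊞-assoc (d u a) (w e) (len p) ⟩
      d u a ⊞ (w e ⊞ len p)     ≤⟨ tight ⟩
      d u v                     ∎

    tight-source : d c u ≈ d a u ⊞ w e
    tight-source = ≲-antisym
      (begin
        d c u            ≤⟨ d-triangle c a u ⟩
        d c a ⊞ d a u    ≤⟨ ⊞-mono-≲ (≲-trans (≈⇒≲ (d-sym c a)) (d-edge e)) ≲-refl ⟩
        w e ⊞ d a u      ≈⟨ ⊞-comm (w e) (d a u) ⟩
        d a u ⊞ w e      ∎)
      (⊞-cancelʳ-≲ (len p) (begin
        (d a u ⊞ w e) ⊞ len p    ≈⟨ ⊞-assoc (d a u) (w e) (len p) ⟩
        d a u ⊞ (w e ⊞ len p)    ≈⟨ ⊞-cong (d-sym a u) ≈-refl ⟩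
        d u a ⊞ (w e ⊞ len p)    ≤⟨ tight ⟩
        d u v                    ≤⟨ d-triangle u c v ⟩
        d u c ⊞ d c v            ≤⟨ ⊞-mono-≲ (≈⇒≲ (d-sym u c)) shortest ⟩
        d c u ⊞ len p            ∎))

    tight-target : d a v ≈ d c v ⊞ w e
    tight-target = ≲-antisym
      (begin
        d a v            ≤⟨ d-triangle a c v ⟩
        d a c ⊞ d c v    ≤⟨ ⊞-mono-≲ (d-edge e) ≲-refl ⟩
        w e ⊞ d c v      ≈⟨ ⊞-comm (w e) (d c v) ⟩
        d c v ⊞ w e      ∎)
      (⊞-cancelʳ-≲ (d u a) (begin
        (d c v ⊞ w e) ⊞ d u a    ≤⟨ ⊞-mono-≲ (⊞-mono-≲ shortest ≲-refl) ≲-refl ⟩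
        (len p ⊞ w e) ⊞ d u a    ≈⟨ solve 3 (λ l w d → ((l ⊕ w) ⊕ d) ⊜ (d ⊕ (w ⊕ l))) ≈-refl (len p) (w e) (d u a) ⟩
        d u a ⊞ (w e ⊞ len p)    ≤⟨ tight ⟩
        d u v                    ≤⟨ d-triangle u a v ⟩
        d u a ⊞ d a v            ≈⟨ ⊞-comm (d u a) (d a v) ⟩
        d a v ⊞ d u a            ∎))

  -- The hypothesis makes p a final segment of a geodesic from u to v.
  potential-geodesic : ∀ {u v a} (p : Walk a v) → d u a ⊞ len p ≲ d u v →
    heads p u ≈ tails p u ⊞ S-len p × tails p v ≈ heads p v ⊞ S-len p
  potential-geodesic ε _ = ≈-sym (⊞-identityʳ 0ℝ) , ≈-sym (⊞-identityʳ 0ℝ)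
  potential-geodesic {u} {v} (_◅_ {a} {c} e p) tight
    with S? a c
  ... | no _  = potential-geodesic p (tight-tail e p tight)
  ... | yes _ =
    ≈-trans (⊞-cong (tight-source e p tight) (proj₁ ih)) (interchange (d a u) (w e) (tails p u) (S-len p)) ,
    ≈-trans (⊞-cong (tight-target e p tight) (proj₂ ih)) (interchange (d c v) (w e) (heads p v) (S-len p))
    where ih = potential-geodesic p (tight-tail e p tight)

  -- The potential of `p` drops from u to v by exactly twice `S-len p`, and along `q` it can drop by
  -- at most twice `S-len q`.
  S-len-minimal : ∀ {u v} (p q : Walk u v) → len p ≲ d u v → S-len p ≲ S-len q
  S-len-minimal {u} {v} p q tight =
    let hu , tv = potential-geodesic {u} p (begin
          d u u ⊞ len p   ≈⟨ ⊞-cong (d-refl u) ≈-refl ⟩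
          0ℝ ⊞ len p      ≈⟨ ⊞-identityˡ (len p) ⟩
          len p           ≤⟨ tight ⟩
          d u v           ∎)
    in halve-≲ (⊞-cancelʳ-≲ (tails p u ⊞ heads p v) (begin
      (S-len p ⊞ S-len p) ⊞ (tails p u ⊞ heads p v)
        ≈⟨ solve 3 (λ s t h → ((s ⊕ s) ⊕ (t ⊕ h)) ⊜ ((t ⊕ s) ⊕ (h ⊕ s))) ≈-refl (S-len p) (tails p u) (heads p v) ⟩
      (tails p u ⊞ S-len p) ⊞ (heads p v ⊞ S-len p)
        ≈⟨ ⊞-cong hu tv ⟨
      heads p u ⊞ tails p v
        ≤⟨ potential-lipschitz p q ⟩
      (heads p v ⊞ tails p u) ⊞ (S-len q ⊞ S-len q)
        ≈⟨ solve 3 (λ h t s → ((h ⊕ t) ⊕ (s ⊕ s)) ⊜ ((s ⊕ s) ⊕ (t ⊕ h))) ≈-refl (heads p v) (tails p u) (S-len q) ⟩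
      (S-len q ⊞ S-len q) ⊞ (tails p u ⊞ heads p v) ∎))

-- Finite quotients

↔-injective : ∀ {A B : Set} (β : A ↔ B) → Injective _≡_ _≡_ (Inverse.to β)
↔-injective β {x} {y} eq =
  trans (sym (Inverse.strictlyInverseʳ β x)) (trans (cong (Inverse.from β) eq) (Inverse.strictlyInverseʳ β y))

-- Numbering the classes by `Fin n` makes the quotient finite and its equality propositional.
record Quotient {A : Set} (_~_ : A → A → Set) (n : ℕ) : Set where
  field
    class    : A → Fin n
    rep      : Fin n → A
    class-rep : ∀ i → class (rep i) ≡ i
    sound    : ∀ {x y} → x ~ y → class x ≡ class y
    exact    : ∀ {x y} → class x ≡ class y → x ~ y

module _ (em : ExcludedMiddle 0ℓ) where

  -- Induction on `n`: after the successors are classified, `zero` either joins the class of some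
  -- `i₀` or forms a class of its own.
  quotient-Fin : ∀ n (_~_ : Fin n → Fin n → Set) → IsEquivalence _~_ → ∃[ k ] Quotient _~_ k
  quotient-Fin zero _ _ = 0 , record
    { class = λ () ; rep = λ () ; class-rep = λ () ; sound = λ { {()} } ; exact = λ { {()} } }
  quotient-Fin (suc n) _~_ eqv with quotient-Fin n (λ i j → suc i ~ suc j)
    (record { refl = E.refl ; sym = E.sym ; trans = E.trans }) | em {∃[ i ] zero ~ suc i}
    where module E = IsEquivalence eqv
  ... | k , Q | yes (i₀ , 0~i₀) = k , record
    { class = c ; rep = suc ∘ Q.rep ; class-rep = Q.class-rep ; sound = λ {x} {y} → snd x y ; exact = λ {x} {y} → ext x y }
    where
    module Q = Quotient Q
    module E = IsEquivalence eqv
    c : Fin (suc n) → Fin k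
    c zero    = Q.class i₀
    c (suc i) = Q.class i
    snd : ∀ x y → x ~ y → c x ≡ c y
    snd zero    zero    _ = refl
    snd zero    (suc y) r = Q.sound (E.trans (E.sym 0~i₀) r)
    snd (suc x) zero    r = Q.sound (E.trans r 0~i₀)
    snd (suc x) (suc y) r = Q.sound r
    ext : ∀ x y → c x ≡ c y → x ~ y
    ext zero    zero    _  = E.refl
    ext zero    (suc y) eq = E.trans 0~i₀ (Q.exact eq)
    ext (suc x) zero    eq = E.trans (Q.exact eq) (E.sym 0~i₀)
    ext (suc x) (suc y) eq = Q.exact eq
  ... | k , Q | no isolated = suc k , record
    { class = c ; rep = r ; class-rep = c-r ; sound = λ {x} {y} → snd x y ; exact = λ {x} {y} → ext x y }
    where
    module Q = Quotient Q
    module E = IsEquivalence eqv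
    c : Fin (suc n) → Fin (suc k)
    c zero    = zero
    c (suc i) = suc (Q.class i)
    r : Fin (suc k) → Fin (suc n)
    r zero    = zero
    r (suc i) = suc (Q.rep i)
    c-r : ∀ i → c (r i) ≡ i
    c-r zero    = refl
    c-r (suc i) = cong suc (Q.class-rep i)
    snd : ∀ x y → x ~ y → c x ≡ c y
    snd zero    zero    _ = refl
    snd zero    (suc y) p = ⊥-elim (isolated (y , p))
    snd (suc x) zero    p = ⊥-elim (isolated (x , E.sym p))
    snd (suc x) (suc y) p = cong suc (Q.sound p)
    ext : ∀ x y → c x ≡ c y → x ~ y
    ext zero    zero    _  = E.refl
    ext zero    (suc y) ()
    ext (suc x) zero    ()
    ext (suc x) (suc y) eq = Q.exact (Fin.suc-injective eq)

  quotient : ∀ {A : Set} {n} → A ↔ Fin (suc n) → (_~_ : A → A → Set) → IsEquivalence _~_ →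
             ∃[ k ] Quotient _~_ (suc k)
  quotient {A} {n} β _~_ eqv with quotient-Fin (suc n) (λ i j → from i ~ from j)
    (record { refl = E.refl ; sym = E.sym ; trans = E.trans })
    where
    open Inverse β using (from)
    module E = IsEquivalence eqv
  ... | zero , Q = ⊥-elim (Fin.¬Fin0 (Quotient.class Q zero))
  ... | suc k , Q = k , record
    { class = Q.class ∘ to
    ; rep = from ∘ Q.rep
    ; class-rep = λ i → trans (cong Q.class (strictlyInverseˡ (Q.rep i))) (Q.class-rep i)
    ; sound = λ {x} {y} x~y → Q.sound (subst₂ _~_ (sym (strictlyInverseʳ x)) (sym (strictlyInverseʳ y)) x~y)
    ; exact = λ {x} {y} eq → subst₂ _~_ (strictlyInverseʳ x) (strictlyInverseʳ y) (Q.exact eq)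
    }
    where
    open Inverse β
    module Q = Quotient Q

  -- Distinct classes have distinct representatives, and x and y, sharing a class, are not both
  -- representatives. Hence k + 1 ≤ n, while a bijection would give n ≤ k.
  collapsing-quotient-smaller : ∀ {A : Set} {n k} {_~_ : A → A → Set} → A ↔ Fin n → Quotient _~_ k →
    ∀ {x y} → x ≢ y → x ~ y → ¬ (Fin k ↔ A)
  collapsing-quotient-smaller {A} {n} {k} β Q {x} {y} x≢y x~y γ = missed (em {rep (class x) ≡ x})
    where
    open Quotient Q
    rep-injective : ∀ {i j} → rep i ≡ rep j → i ≡ j
    rep-injective {i} {j} eq = trans (sym (class-rep i)) (trans (cong class eq) (class-rep j))

    not-missed : ∀ z → ¬ (∀ i → rep i ≢ z)
    not-missed z rep≢z = ℕ.1+n≰n (ℕ.≤-trans (Fin.injective⇒≤ {f = f} (f-injective _ _))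
      (Fin.injective⇒≤ {f = Inverse.from γ ∘ Inverse.from β} from-injective))
      where
      f : Fin (suc k) → Fin n
      f zero    = Inverse.to β z
      f (suc i) = Inverse.to β (rep i)
      f-injective : ∀ i j → f i ≡ f j → i ≡ j
      f-injective zero    zero    _  = refl
      f-injective zero    (suc j) eq = ⊥-elim (rep≢z j (sym (↔-injective β eq)))
      f-injective (suc i) zero    eq = ⊥-elim (rep≢z i (↔-injective β eq))
      f-injective (suc i) (suc j) eq = cong suc (rep-injective (↔-injective β eq))
      from-injective : Injective _≡_ _≡_ (Inverse.from γ ∘ Inverse.from β)
      from-injective = ↔-injective (↔-sym β) ∘ ↔-injective (↔-sym γ)

    missed : Dec (rep (class x) ≡ x) → ⊥
    missed (yes eq) = not-missed y λ i repᵢ≡y →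
      x≢y (trans (sym eq) (trans (cong rep (trans (sound x~y) (trans (cong class (sym repᵢ≡y)) (class-rep i)))) repᵢ≡y))
    missed (no neq) = not-missed x λ i repᵢ≡x →
      neq (trans (cong rep (trans (cong class (sym repᵢ≡x)) (class-rep i))) repᵢ≡x)

-- Contractions

module Contraction (em : ExcludedMiddle 0ℓ) (K : Graph) {M : Walks.MinimalMetric (weighted K)}
  (C : OrthogonalClass (weighted K) M) where

  open Graph K hiding (weighted)
  open Walks (weighted K)
  open MinimalMetric M using (minimal)
  open OrthogonalClass C
  open EdgeClass C public using (inS; S-len; S-len-minimal)
  open ≲-Reasoning

  Avoiding : V → V → Set
  Avoiding u v = Adj u v × ¬ S u v

  infix 4 _~_

  -- The classes are the components that remain when the edges in `S` are deleted.
  _~_ : V → V → Set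
  _~_ = Star Avoiding

  ~-sym : ∀ {u v} → u ~ v → v ~ u
  ~-sym = Star.reverse λ (e , ¬s) → adj-sym e , ¬s ∘ S-sym

  ~-isEquivalence : IsEquivalence _~_
  ~-isEquivalence = record { refl = ε ; sym = ~-sym ; trans = _◅◅_ }

  avoiding-walk : ∀ {u v} → u ~ v → Σ[ p ∈ Walk u v ] S-len p ≈ 0ℝ
  avoiding-walk ε = ε , ≈-refl
  avoiding-walk (_◅_ {u} {v} (e , ¬s) r) = let p , p≈ = avoiding-walk r in e ◅ p , ≈-trans (skip p) p≈
    where
    skip : ∀ {z} (p : Walk v z) → S-len (e ◅ p) ≈ S-len p
    skip p with S? u v
    ... | yes s = ⊥-elim (¬s s)
    ... | no _  = ≈-refl

  S-len-edge : ∀ {u v z} (e : Adj u v) (p : Walk v z) → S u v → S-len (e ◅ p) ≈ w e ⊞ S-len p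
  S-len-edge {u} {v} e p s with S? u v
  ... | yes _ = ≈-refl
  ... | no ¬s = ⊥-elim (¬s s)

  -- By minimality the single edge is a geodesic, so `S-len-minimal` applies to it.
  w≲S-len : ∀ {u v} (e : Adj u v) → S u v → (p : Walk u v) → w e ≲ S-len p
  w≲S-len {u} {v} e s p = begin
    w e               ≈⟨ ⊞-identityʳ (w e) ⟨
    w e ⊞ 0ℝ          ≈⟨ S-len-edge e ε s ⟨
    S-len (e ◅ ε)     ≤⟨ S-len-minimal (e ◅ ε) p (≲-trans (≈⇒≲ (⊞-identityʳ (w e))) (minimal e)) ⟩
    S-len p           ∎

  -- A walk outside `S` would have `S`-length zero, less than `w e`. This keeps the contraction free
  -- of loops.
  S-edge⇒≁ : ∀ {u v} (e : Adj u v) → S u v → ¬ u ~ v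
  S-edge⇒≁ e s r = let p , p≈ = avoiding-walk r in
    w-≴0 e (≲-trans (w≲S-len e s p) (≈⇒≲ p≈))

  -- Going from a to b by way of `e′` costs only `w e′` in `S`-length, and symmetrically. Thus the
  -- weight of a contracted edge does not depend on its representative.
  w-~-cong : ∀ {a b a′ b′} (e : Adj a b) → S a b → (e′ : Adj a′ b′) → S a′ b′ →
             a ~ a′ → b ~ b′ → w e ≈ w e′
  w-~-cong e s e′ s′ a~a′ b~b′ =
    ≲-antisym (half e s e′ s′ a~a′ b~b′) (half e′ s′ e s (~-sym a~a′) (~-sym b~b′))
    where
    half : ∀ {a b a′ b′} (e : Adj a b) → S a b → (e′ : Adj a′ b′) → S a′ b′ →
           a ~ a′ → b ~ b′ → w e ≲ w e′
    half e s e′ s′ a~a′ b~b′ =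
      let p , p≈ = avoiding-walk a~a′
          q , q≈ = avoiding-walk (~-sym b~b′)
      in begin
        w e                            ≤⟨ w≲S-len e s (p ◅◅ e′ ◅ q) ⟩
        S-len (p ◅◅ e′ ◅ q)            ≈⟨ part-◅◅ inS p (e′ ◅ q) ⟩
        S-len p ⊞ S-len (e′ ◅ q)       ≈⟨ ⊞-cong p≈ (≈-trans (S-len-edge e′ q s′) (⊞-cong ≈-refl q≈)) ⟩
        0ℝ ⊞ (w e′ ⊞ 0ℝ)               ≈⟨ ≈-trans (⊞-identityˡ (w e′ ⊞ 0ℝ)) (⊞-identityʳ (w e′)) ⟩
        w e′                           ∎

  opaque
    classes : ∃[ k ] Quotient _~_ (suc k)
    classes = quotient em (proj₂ finite) _~_ ~-isEquivalence

  size : ℕ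
  size = proj₁ classes

  V/~ : Quotient _~_ (suc size)
  V/~ = proj₂ classes

  open Quotient V/~ public

  contractedWeighted : WeightedGraph
  contractedWeighted = record
    { V = Fin (suc size)
    ; Adj = λ A B → ∃₂ λ a b → class a ≡ A × class b ≡ B × Adj a b × S a b
    ; w = λ (_ , _ , _ , _ , e , _) → w e
    ; adj-sym = λ (a , b , a∈A , b∈B , e , s) → b , a , b∈B , a∈A , adj-sym e , S-sym s
    ; adj-irrefl = λ (_ , _ , a∈A , b∈A , e , s) → S-edge⇒≁ e s (exact (trans a∈A (sym b∈A)))
    ; w-sym = λ (_ , _ , a∈A , b∈B , e , s) (_ , _ , b′∈B , a′∈A , e′ , s′) →
        un≈ (≈-trans
          (w-~-cong e s (adj-sym e′) (S-sym s′) (exact (trans a∈A (sym a′∈A))) (exact (trans b∈B (sym b′∈B))))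
          (w-adj-sym e′))
    ; w-pos = λ (_ , _ , _ , _ , e , _) → w-pos e
    }

  private
    module C  = WeightedGraph contractedWeighted
    module CW = Walks contractedWeighted

  contract-walk : ∀ {u v} → Walk u v → C.Walk (class u) (class v)
  contract-walk ε = ε
  contract-walk {v = z} (_◅_ {u} {v} e p) with S? u v
  ... | yes s = (u , v , refl , refl , e , s) ◅ contract-walk p
  ... | no ¬s = subst (λ A → C.Walk A (class z)) (sym (sound ((e , ¬s) ◅ ε))) (contract-walk p)

  contracted : Graph
  contracted = record
    { weighted = contractedWeighted
    ; finite = size , ↔-id _
    ; connected = λ A B → subst₂ C.Walk (class-rep A) (class-rep B) (contract-walk (connected (rep A) (rep B)))
    }

  -- Where consecutive edges of `q` do not meet in `K`, their ends lie in one class and are joined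
  -- by a walk of `S`-length zero.
  lift-walk : ∀ {A B} (q : C.Walk A B) {u v} → class u ≡ A → class v ≡ B →
              Σ[ p ∈ Walk u v ] S-len p ≈ CW.len q
  lift-walk ε u∈A v∈A = avoiding-walk (exact (trans u∈A (sym v∈A)))
  lift-walk ((a , b , a∈A , b∈B , e , s) ◅ q) u∈A v∈C =
    let p , p≈ = avoiding-walk (exact (trans u∈A (sym a∈A)))
        r , r≈ = lift-walk q b∈B v∈C
    in p ◅◅ e ◅ r , (begin-equality
      S-len (p ◅◅ e ◅ r)             ≈⟨ part-◅◅ inS p (e ◅ r) ⟩
      S-len p ⊞ S-len (e ◅ r)        ≈⟨ ⊞-cong p≈ (≈-trans (S-len-edge e r s) (⊞-cong ≈-refl r≈)) ⟩
      0ℝ ⊞ (w e ⊞ CW.len q)          ≈⟨ ⊞-identityˡ (w e ⊞ CW.len q) ⟩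
      w e ⊞ CW.len q                 ∎)

  not-K₁ : ∀ {u v} → Adj u v → S u v → ¬ IsK₁ contracted
  not-K₁ {u} {v} e s k₁ = S-edge⇒≁ e s (exact (↔-injective k₁ refl))

  smaller : ∀ {u v} → Adj u v → ¬ S u v → ¬ contracted ≅ K
  smaller {u} e ¬s iso = collapsing-quotient-smaller em (proj₂ finite) V/~
    (λ u≡v → adj-irrefl (subst (Adj u) (sym u≡v) e)) ((e , ¬s) ◅ ε) (_≅_.bijection iso)

-- The two-term pseudofactorization given by an orthogonal class

module Splitting (em : ExcludedMiddle 0ℓ) (K : Graph) {M : Walks.MinimalMetric (weighted K)}
  (C : OrthogonalClass (weighted K) M) where

  open Graph K hiding (weighted)
  open Walks (weighted K)
  open MinimalMetric M using (d; isDist)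
  open OrthogonalClass C

  private
    -- `A` retains the edges in `S`, and `B` those outside.
    module A = Contraction em K C
    module B = Contraction em K (complement C)

    F : Fin 2 → Graph
    F zero       = A.contracted
    F (suc zero) = B.contracted

    module F*  = WeightedGraph (∏ F)
    module F*W = Walks (∏ F)
    open Product F

  factor-map : V → F*.V
  factor-map u = A.class u , B.class u , tt

  edge-over-S : ∀ {u v} → Adj u v → S u v → F*.Adj (factor-map u) (factor-map v)
  edge-over-S {u} {v} e s = zero , (u , v , refl , refl , e , s) , λ
    { zero 0≢0 → ⊥-elim (0≢0 refl) ; (suc zero) _ → B.sound ((e , λ ¬s → ¬s s) ◅ ε) }

  edge-over-¬S : ∀ {u v} → Adj u v → ¬ S u v → F*.Adj (factor-map u) (factor-map v)
  edge-over-¬S {u} {v} e ¬s = suc zero , (u , v , refl , refl , e , ¬s) , λ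
    { zero _ → A.sound ((e , ¬s) ◅ ε) ; (suc zero) 1≢1 → ⊥-elim (1≢1 refl) }

  factor-edge : ∀ {u v} (e : Adj u v) → Σ[ e* ∈ F*.Adj (factor-map u) (factor-map v) ] w e ≈ F*.w e*
  factor-edge {u} {v} e = by-class (S? u v)
    where
    by-class : Dec (S u v) → Σ[ e* ∈ F*.Adj (factor-map u) (factor-map v) ] w e ≈ F*.w e*
    by-class (yes s) = edge-over-S e s , ≈-refl {w e}
    by-class (no ¬s) = edge-over-¬S e ¬s , ≈-refl {w e}

  factor-walk : ∀ {u v} (p : Walk u v) → Σ[ p* ∈ F*.Walk (factor-map u) (factor-map v) ] F*W.len p* ≈ len p
  factor-walk ε = ε , ≈-refl
  factor-walk (e ◅ p) =
    let e* , w≈ = factor-edge e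
        p* , p≈ = factor-walk p
    in e* ◅ p* , ⊞-cong (≈-sym w≈) p≈

  off₀≈on₁ : ∀ {x y} (p : F*.Walk x y) → off zero p ≈ on (suc zero) p
  off₀≈on₁ ε = ≈-refl
  off₀≈on₁ ((zero , _) ◅ p) = off₀≈on₁ p
  off₀≈on₁ ((suc zero , _) ◅ p) = ⊞-cong ≈-refl (off₀≈on₁ p)

  -- A geodesic maps to a walk of the same length. Conversely, the two projections of a walk `r` in
  -- the product lift separately to `K`; the geodesic has least weight in each class, so it is no
  -- longer than `r`.
  factor-isometry : ∀ u v → F*W.Geodesic (factor-map u) (factor-map v) (d u v)
  factor-isometry u v =
    let p* , p*≈ = factor-walk p
    in Walks.geodesic p* (≈-trans p*≈ p≈d) λ r →
      let q , q≈ = project zero r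
          q′ , q′≈ = project (suc zero) r
          s , s≈ = A.lift-walk q refl refl
          s′ , s′≈ = B.lift-walk q′ refl refl
      in begin
        d u v                                       ≈⟨ p≈d ⟨
        -- The second summand is `B.S-len p` because `does` of a negated decision computes to `not`.
        len p                                       ≈⟨ len-split A.inS p ⟩
        A.S-len p ⊞ B.S-len p           ≤⟨ ⊞-mono-≲ (A.S-len-minimal p s (≈⇒≲ p≈d)) (B.S-len-minimal p s′ (≈⇒≲ p≈d)) ⟩
        A.S-len s ⊞ B.S-len s′                ≈⟨ ⊞-cong (≈-trans s≈ q≈) (≈-trans s′≈ q′≈) ⟩
        on zero r ⊞ on (suc zero) r                 ≈⟨ ⊞-cong ≈-refl (off₀≈on₁ r) ⟨
        on zero r ⊞ off zero r                      ≈⟨ len≈on⊞off zero r ⟨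
        F*W.len r                                   ∎
    where
    open ≲-Reasoning
    p = Geodesic.walk (isDist u v)
    p≈d = Geodesic.len≈ (isDist u v)

  module _ {a b x y} (eₛ : Adj a b) (s : S a b) (eₜ : Adj x y) (t : ¬ S x y) where

    pseudofactorization : Pseudofactorization K F
    pseudofactorization = record
      { m≥1 = s≤s z≤n
      ; π = factor-map
      ; isometric = λ u v → d u v , Geodesic⇒IsDistance (isDist u v) , F*W.Geodesic⇒IsDistance (factor-isometry u v)
      ; edges = λ e → let e* , w≈ = factor-edge e in e* , un≈ w≈
      ; vertices-covered = λ { zero x → A.rep x , A.class-rep x ; (suc zero) x → B.rep x , B.class-rep x }
      ; edges-covered = λ
        { zero (u , v , refl , refl , e , s) → u , v , e , (λ eq → A.S-edge⇒≁ e s (A.exact eq)) , refl , refl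
        ; (suc zero) (u , v , refl , refl , e , t) → u , v , e , (λ eq → B.S-edge⇒≁ e t (B.exact eq)) , refl , refl }
      ; no-K₁ = λ { zero k₁ → ⊥-elim (A.not-K₁ eₛ s k₁) ; (suc zero) k₁ → ⊥-elim (B.not-K₁ eₜ t k₁) }
      }

    -- Each factor collapses the edge given in the other class, so it has too few vertices to be
    -- isomorphic to `K`.
    split⇒reducible : ¬ Irreducible K
    split⇒reducible irr with irr F pseudofactorization
    ... | zero , iso     = A.smaller eₜ t iso
    ... | suc zero , iso = B.smaller eₛ (λ ¬s → ¬s s) iso

-- Uniqueness

edgeless⇒K₁ : (K : Graph) → (∀ {a b} → ¬ Graph.Adj K a b) → IsK₁ K
edgeless⇒K₁ K edgeless = mk↔ₛ′ (λ _ → tt) (λ _ → base) (λ _ → refl) (λ x → endpoints≡ (connected base x))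
  where
  open Graph K
  base : V
  base = Inverse.from (proj₂ finite) zero
  endpoints≡ : ∀ {a b} → Walk a b → a ≡ b
  endpoints≡ ε       = refl
  endpoints≡ (e ◅ _) = ⊥-elim (edgeless e)

module Refinement
  (em : ExcludedMiddle 0ℓ)
  (G : Graph) (M : Walks.MinimalMetric (weighted G))
  {p r} (Gs : Fin p → Graph) (Hs : Fin r → Graph)
  (A : Pseudofactorization G Gs) (B : Pseudofactorization G Hs)
  where

  private
    module G   = Graph G
    module A   = Factorization G M Gs A
    module B   = Factorization G M Hs B
    module AP  = Product Gs
    module BP  = Product Hs
    module Gs i = Graph (Gs i)
    module Hs j = Graph (Hs j)
    open Pseudofactorization A using () renaming (π to α)
    open Pseudofactorization B using () renaming (π to β)
    module PA = Pseudofactorization A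

  infix 9 _‼ᴬ_ _‼ᴮ_

  _‼ᴬ_ : G.V → ∀ i → Gs.V i
  u ‼ᴬ i = AP._‼_ (α u) i

  _‼ᴮ_ : G.V → ∀ j → Hs.V j
  u ‼ᴮ j = BP._‼_ (β u) j

  -- The relation holds in `G` by the second pseudofactorization and descends to `Gs i` by the
  -- first.
  orthogonal-in-factor : ∀ {i j u v x y} → A.EdgeAt i u v → B.EdgeAt j u v → A.EdgeAt i x y → x ‼ᴮ j ≡ y ‼ᴮ j →
    A.D i (u ‼ᴬ i) (x ‼ᴬ i) ⊞ A.D i (v ‼ᴬ i) (y ‼ᴬ i) ≈ A.D i (u ‼ᴬ i) (y ‼ᴬ i) ⊞ A.D i (v ‼ᴬ i) (x ‼ᴬ i)
  orthogonal-in-factor {i} {j} uv uv′ xy x≡y =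
    A.orthogonal-project i (A.same-off (A.parentEdge uv)) (A.same-off (A.parentEdge xy))
      (B.orthogonal j (B.same-off (B.parentEdge uv′)) x≡y)

  -- The left side vanishes, and the right side is at least the positive weight of the edge.
  not-self-orthogonal : ∀ i {a b} → Gs.Adj i a b → ¬ (A.D i a a ⊞ A.D i b b ≈ A.D i a b ⊞ A.D i b a)
  not-self-orthogonal i {a} {b} e h = W.w-≴0 e (begin
    Gs.w i e                      ≤⟨ A.D-minimal i e ⟩
    A.D i a b                     ≤⟨ x≲x⊞y (A.D i a b) (≲-trans (W.w-nonneg ē) (A.D-minimal i ē)) ⟩
    A.D i a b ⊞ A.D i b a         ≈⟨ h ⟨
    A.D i a a ⊞ A.D i b b         ≈⟨ ⊞-cong (d-refl a) (d-refl b) ⟩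
    0ℝ ⊞ 0ℝ                       ≈⟨ ⊞-identityˡ 0ℝ ⟩
    0ℝ                            ∎)
    where
    open ≲-Reasoning
    module W = Walks (weighted (Gs i))
    open W.MinimalMetric (A.factorMetric i) using (d-refl)
    ē = Gs.adj-sym i e

  -- If xy had another index `j′`, the parent of uv would be in the class `S` below and the parent
  -- of xy outside it, so `Gs i` would split.
  refines : ∀ {i} → Irreducible (Gs i) → ∀ {j u v x y} →
            A.EdgeAt i u v → B.EdgeAt j u v → A.EdgeAt i x y → B.EdgeAt j x y
  refines {i} irr {j} {u} {v} {x} {y} uv uv′ xy with B.edge-index (proj₁ xy)
  ... | j′ , xy′ with j Fin.≟ j′
  ... | yes refl = xy′
  ... | no j≢j′  = ⊥-elim (split⇒reducible (A.parent (A.parentEdge uv)) (u , v , uv , uv′ , refl , refl)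
                                           (A.parent (A.parentEdge xy)) xy∉S irr)
    where
    S : Gs.V i → Gs.V i → Set
    S a b = ∃₂ λ u v → A.EdgeAt i u v × B.EdgeAt j u v × u ‼ᴬ i ≡ a × v ‼ᴬ i ≡ b

    S-sym : ∀ {a b} → S a b → S b a
    S-sym (u , v , (e , u≢v) , (e′ , u≢v′) , u≡a , v≡b) =
      v , u , (G.adj-sym e , u≢v ∘ sym) , (G.adj-sym e′ , u≢v′ ∘ sym) , v≡b , u≡a

    coordinate≡ : ∀ {x y} → A.EdgeAt i x y → ¬ B.EdgeAt j x y → x ‼ᴮ j ≡ y ‼ᴮ j
    coordinate≡ {x} {y} (e , _) ∉j with em {x ‼ᴮ j ≡ y ‼ᴮ j}
    ... | yes x≡y = x≡y
    ... | no x≢y  = ⊥-elim (∉j (e , x≢y))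

    orth : ∀ {a b x y} → Gs.Adj i a b → S a b → Gs.Adj i x y → ¬ S x y →
           A.D i a x ⊞ A.D i b y ≈ A.D i a y ⊞ A.D i b x
    -- No edge of `G` over `f` has index `j`, so any one of them can serve.
    orth _ (u , v , uv , uv′ , refl , refl) f ∉S with PA.edges-covered i f
    ... | x , y , e , x≢y , refl , refl = orthogonal-in-factor uv uv′ (e , x≢y)
      (coordinate≡ (e , x≢y) λ xy′ → ∉S (x , y , (e , x≢y) , xy′ , refl , refl))

    -- Otherwise the parent of xy is also the parent of an edge with index `j`. That edge is
    -- orthogonal to xy in `G`, so their common parent would be orthogonal to itself.
    xy∉S : ¬ S (x ‼ᴬ i) (y ‼ᴬ i)
    xy∉S (u , v , uv , uv′ , u≡x , v≡y) = not-self-orthogonal i (A.parent (A.parentEdge xy))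
      (subst₂ (λ a b → A.D i a (x ‼ᴬ i) ⊞ A.D i b (y ‼ᴬ i) ≈ A.D i a (y ‼ᴬ i) ⊞ A.D i b (x ‼ᴬ i)) u≡x v≡y
        (orthogonal-in-factor uv uv′ xy (coordinate≡ xy λ xy″ → j≢j′ (B.edgeAt-unique xy″ xy′))))

    edgesOverJ : OrthogonalClass (weighted (Gs i)) (A.factorMetric i)
    edgesOverJ = record { S = S ; S? = λ _ _ → em ; S-sym = S-sym ; orth = orth }

    open Splitting em (Gs i) edgesOverJ

  edge-at : ¬ IsK₁ G → ∀ i → ∃₂ λ u v → A.EdgeAt i u v
  edge-at G≇K₁ i with em {∃₂ λ a b → Gs.Adj i a b}
  ... | yes (_ , _ , e) = let u , v , e′ , u≢v , _ = PA.edges-covered i e in u , v , e′ , u≢v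
  -- A factor without edges is K₁ by connectedness.
  ... | no edgeless     = ⊥-elim (G≇K₁ (proj₁ (PA.no-K₁ i (edgeless⇒K₁ (Gs i) λ e → edgeless (_ , _ , e)))))

  module _ (irr : ∀ i → Irreducible (Gs i)) (G≇K₁ : ¬ IsK₁ G) where

    -- By `refines`, any other edge with index `i` would give the same value.
    index : Fin p → Fin r
    index i = let _ , _ , e , _ = edge-at G≇K₁ i in proj₁ (B.edge-index e)

    edgeAt-index : ∀ {i u v} → A.EdgeAt i u v → B.EdgeAt (index i) u v
    edgeAt-index {i} = let _ , _ , e = edge-at G≇K₁ i in refines (irr i) e (proj₂ (B.edge-index (proj₁ e)))

  module _ {i j} (same : ∀ {u v} → A.EdgeAt i u v → B.EdgeAt j u v)
                 (same⁻¹ : ∀ {u v} → B.EdgeAt j u v → A.EdgeAt i u v) where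

    -- Some walk from u to v has no edge with index `i`. None of its edges then has index `j` on the
    -- other side, so the `j`-th coordinate is constant along it.
    same-coordinate : ∀ {u v} → u ‼ᴬ i ≡ v ‼ᴬ i → u ‼ᴮ j ≡ v ‼ᴮ j
    same-coordinate u≡v = let p , h = A.same-coordinate⇒avoids i u≡v in along p h
      where
      along : ∀ {u v} (p : G.Walk u v) → AP.on i (A.push p) ≲ 0ℝ → u ‼ᴮ j ≡ v ‼ᴮ j
      along ε _ = refl
      along (_◅_ {u} {v} e p) h with A.avoids-head i e p h | em {u ‼ᴮ j ≡ v ‼ᴮ j}
      ... | _ , h′   | yes u≡v = trans u≡v (along p h′)
      ... | u≡v , _  | no u≢v  = ⊥-elim (proj₂ (same⁻¹ (e , u≢v)) u≡v)

    -- Well defined in that `transfer-coordinate` holds for every preimage, not only the chosen one.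
    transfer : Gs.V i → Hs.V j
    transfer a = proj₁ (PA.vertices-covered i a) ‼ᴮ j

    transfer-coordinate : ∀ u → transfer (u ‼ᴬ i) ≡ u ‼ᴮ j
    transfer-coordinate u = same-coordinate (proj₂ (PA.vertices-covered i (u ‼ᴬ i)))

    transfer-edge : ∀ {a b} (e : Gs.Adj i a b) →
                    Σ[ e′ ∈ Hs.Adj j (transfer a) (transfer b) ] Gs.w i e ≈ Hs.w j e′
    transfer-edge e with PA.edges-covered i e
    ... | u , v , f , u≢v , refl , refl =
      let E = A.parentEdge (f , u≢v)
          E′ = B.parentEdge (f , proj₂ (same (f , u≢v)))
          e′ = subst₂ (Hs.Adj j) (sym (transfer-coordinate u)) (sym (transfer-coordinate v)) (B.parent E′)
      in e′ , (begin-equality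
        Gs.w i e                ≈⟨ Walks.w-cong (weighted (Gs i)) e (A.parent E) refl refl ⟩
        Gs.w i (A.parent E)     ≈⟨ A.w-parent E ⟨
        G.w f                   ≈⟨ B.w-parent E′ ⟩
        Hs.w j (B.parent E′)    ≈⟨ Walks.w-cong (weighted (Hs j)) e′ (B.parent E′) (transfer-coordinate u) (transfer-coordinate v) ⟨
        Hs.w j e′               ∎)
      where open ≲-Reasoning

module _
  (em : ExcludedMiddle 0ℓ)
  (G : Graph) (M : Walks.MinimalMetric (weighted G))
  {p r} (Gs : Fin p → Graph) (Hs : Fin r → Graph)
  (A : Pseudofactorization G Gs) (B : Pseudofactorization G Hs)
  where

  private
    module A = Factorization G M Gs A
    module B = Factorization G M Hs B
    module AB = Refinement em G M Gs Hs A B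
    module BA = Refinement em G M Hs Gs B A
    module PA = Pseudofactorization A
    module PB = Pseudofactorization B

  same-edges⇒≅ : ∀ {i j} → (∀ {u v} → A.EdgeAt i u v → B.EdgeAt j u v) →
                 (∀ {u v} → B.EdgeAt j u v → A.EdgeAt i u v) → Gs i ≅ Hs j
  same-edges⇒≅ {i} {j} same same⁻¹ = record
    { bijection = mk↔ₛ′ to from to∘from from∘to
    ; adjacency = λ {a} {b} → mk⇔ (λ e → proj₁ (AB.transfer-edge same same⁻¹ e))
        (λ e → subst₂ (Graph.Adj (Gs i)) (from∘to a) (from∘to b) (proj₁ (BA.transfer-edge same⁻¹ same e)))
    ; weight = λ e e′ → let e″ , w≈ = AB.transfer-edge same same⁻¹ e in
        un≈ (≈-trans w≈ (Walks.w-cong (weighted (Hs j)) e″ e′ refl refl))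
    }
    where
    to = AB.transfer same same⁻¹
    from = BA.transfer same⁻¹ same
    to∘from : ∀ b → to (from b) ≡ b
    to∘from b = trans (AB.transfer-coordinate same same⁻¹ (proj₁ (PB.vertices-covered j b))) (proj₂ (PB.vertices-covered j b))
    from∘to : ∀ a → from (to a) ≡ a
    from∘to a = trans (BA.transfer-coordinate same⁻¹ same (proj₁ (PA.vertices-covered i a))) (proj₂ (PA.vertices-covered i a))

  unique-nontrivial : ¬ IsK₁ G → (∀ i → Irreducible (Gs i)) → (∀ j → Irreducible (Hs j)) →
                      Σ[ σ ∈ Fin p ↔ Fin r ] (∀ i → Gs i ≅ Hs (Inverse.to σ i))
  unique-nontrivial G≇K₁ irrA irrB = mk↔ₛ′ σ τ σ∘τ τ∘σ , λ i → same-edges⇒≅ (AB.edgeAt-index irrA G≇K₁)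
    λ {u} {v} uv → subst (λ k → A.EdgeAt k u v) (τ∘σ i) (BA.edgeAt-index irrB G≇K₁ uv)
    where
    σ = AB.index irrA G≇K₁
    τ = BA.index irrB G≇K₁
    -- An edge with index `i` has index `σ i` on the other side, hence also `τ (σ i)` on its own;
    -- indices are unique.
    τ∘σ : ∀ i → τ (σ i) ≡ i
    τ∘σ i = let _ , _ , e = AB.edge-at G≇K₁ i in
      A.edgeAt-unique (BA.edgeAt-index irrB G≇K₁ (AB.edgeAt-index irrA G≇K₁ e)) e
    σ∘τ : ∀ j → σ (τ j) ≡ j
    σ∘τ j = let _ , _ , e = BA.edge-at G≇K₁ j in
      B.edgeAt-unique (AB.edgeAt-index irrA G≇K₁ (BA.edgeAt-index irrB G≇K₁ e)) e

-- An edge of a factor would be the parent of an edge of `G`. So the factor supplied by `m≥1` is K₁,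
-- and `no-K₁` gives the count.
K₁⇒sole-factor : ∀ {G m} {F : Fin m → Graph} → IsK₁ G → Pseudofactorization G F → m ≡ 1
K₁⇒sole-factor {G} {m} {F} k₁ P = proj₂ (no-K₁ i (edgeless⇒K₁ (F i) edgeless))
  where
  open Pseudofactorization P
  i : Fin m
  i = Fin.fromℕ< m≥1
  edgeless : ∀ {a b} → ¬ Graph.Adj (F i) a b
  edgeless e with edges-covered i e
  ... | u , v , e′ , u≢v , _ = Graph.adj-irrefl G (subst (Graph.Adj G u) (sym (↔-injective k₁ refl)) e′)

theorem1p2 : ExcludedMiddle 0ℓ →
    (G : Graph) → Minimal G →
    {p r : ℕ} (Gs : Fin p → Graph) (Hs : Fin r → Graph) →
    Pseudofactorization G Gs → (∀ i → Irreducible (Gs i)) →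
    Pseudofactorization G Hs → (∀ j → Irreducible (Hs j)) →
    Σ[ σ ∈ Fin p ↔ Fin r ] (∀ i → Gs i ≅ Hs (Inverse.to σ i))
theorem1p2 em G min {p} {r} Gs Hs A irrA B irrB = by-triviality (em {IsK₁ G})
  where
  open Graph G hiding (weighted)
  open Walks (weighted G)
  -- The distances of `G` are those attested by the isometry of `A`.
  M : MinimalMetric
  M = record
    { d       = λ u v → proj₁ (isometric u v)
    ; isDist  = isDist
    ; minimal = λ {u} {v} e → ≈⇒≲ (geodesic-unique (IsDistance⇒Geodesic {x = w e} (min e)) (isDist u v))
    }
    where
    open Pseudofactorization A using (isometric)
    isDist : ∀ u v → Geodesic u v (proj₁ (isometric u v))
    isDist u v = IsDistance⇒Geodesic {x = proj₁ (isometric u v)} (proj₁ (proj₂ (isometric u v)))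
  by-triviality : Dec (IsK₁ G) → Σ[ σ ∈ Fin p ↔ Fin r ] (∀ i → Gs i ≅ Hs (Inverse.to σ i))
  by-triviality (no G≇K₁) = unique-nontrivial em G M Gs Hs A B G≇K₁ irrA irrB
  -- Both families have one member. As `G` has no edges, the two indices have the same edges
  -- vacuously.
  by-triviality (yes k₁)  =
    subst₂ (λ m n → Fin m ↔ Fin n) (sym (K₁⇒sole-factor k₁ A)) (sym (K₁⇒sole-factor k₁ B)) (↔-id _) ,
    λ i → same-edges⇒≅ em G M Gs Hs A B (⊥-elim ∘ edgeless ∘ proj₁) (⊥-elim ∘ edgeless ∘ proj₁)
    where
    edgeless : ∀ {u v} → ¬ Adj u v
    edgeless {u} e = adj-irrefl (subst (Adj u) (sym (↔-injective k₁ refl)) e)
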